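{- There exists an adaptive randomized algorithm that, when the treewidth $k$ of the hidden graph is known, solves the Graph Reconstruction problem with a CC oracle using $\mathcal{O}(k^2\log n)$ CC queries, where $n$ is the number of vertices; its output is correct with high probability.
   Context: Graph Reconstruction (GR): an unknown ("hidden") simple undirected graph $G=(V,E)$ on a known vertex set $V$ with $|V|=n$ is to be determined, i.e. the algorithm must output $E$. A CC oracle, on query $S\subseteq V$, returns the partition of $S$ into the vertex sets of the connected components of the induced subgraph $G[S]$; complexity is the number of queries. An adaptive algorithm may choose queries depending on earlier answers. "Correct with high probability" means the output equals the hidden graph with probability tending to $1$ as $n\to\infty$. -}

module Defs where

open import Data.Nat using (ℕ; zero; suc; _≤_; _+_)
open import Data.Bool using (Bool; true; false)
open import Data.Bool.Properties using () renaming (_≟_ to _≟ᵇ_)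
open import Data.Fin using (Fin; zero; suc; inject₁; fromℕ)
open import Data.Fin.Properties using (all?)
open import Data.Fin.Subset using (Subset; _∈_; ∣_∣)
open import Data.Vec using (Vec; []; _∷_)
open import Data.List using (List; []; _∷_; map; _++_; length; filter)
open import Data.Product using (Σ; ∃; _×_; _,_; proj₁; proj₂)
open import Data.Unit using (⊤)
open import Function.Definitions using (Injective)
open import Relation.Binary.PropositionalEquality using (_≡_)
open import Relation.Nullary using (¬_; Dec; ¬?)

record SimpleGraph (n : ℕ) : Set where
  field
    adj    : Fin n → Fin n → Bool
    sym    : ∀ u v → adj u v ≡ adj v u
    irrefl : ∀ v → adj v v ≡ false
open SimpleGraph public

data Walk {m : ℕ} (a : Fin m → Fin m → Bool) (P : Fin m → Set) : Fin m → Fin m → Set where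
  here : ∀ {u} → P u → Walk a P u u
  step : ∀ {u w v} → P u → a u w ≡ true → Walk a P w v → Walk a P u v

ConnectedIn : ∀ {n} → SimpleGraph n → Subset n → Fin n → Fin n → Set
ConnectedIn G S u v = Walk (adj G) (λ x → x ∈ S) u v

record Cycle {m : ℕ} (T : SimpleGraph m) : Set where
  field
    len   : ℕ
    vtx   : Fin (3 + len) → Fin m
    inj   : Injective _≡_ _≡_ vtx
    edges : ∀ (i : Fin (2 + len)) → adj T (vtx (inject₁ i)) (vtx (suc i)) ≡ true
    close : adj T (vtx (fromℕ (2 + len))) (vtx zero) ≡ true

-- A tree: connected and acyclic (nonemptiness is imposed where used).
IsTree : ∀ {m} → SimpleGraph m → Set
IsTree T = (∀ s t → Walk (adj T) (λ _ → ⊤) s t) × ¬ Cycle T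

record TreeDecomposition {n : ℕ} (G : SimpleGraph n) : Set where
  field
    nodes     : ℕ
    T         : SimpleGraph (suc nodes)
    tree      : IsTree T
    bag       : Fin (suc nodes) → Subset n
    cover     : ∀ v → ∃ λ t → v ∈ bag t
    edgeCover : ∀ u v → adj G u v ≡ true → ∃ λ t → u ∈ bag t × v ∈ bag t
    coherent  : ∀ v s t → v ∈ bag s → v ∈ bag t → Walk (adj T) (λ x → v ∈ bag x) s t
open TreeDecomposition public

-- width ≤ w  (width = max bag size - 1)
WidthAtMost : ∀ {n} {G : SimpleGraph n} → TreeDecomposition G → ℕ → Set
WidthAtMost D w = ∀ t → ∣ bag D t ∣ ≤ suc w

HasTreewidth : ∀ {n} → SimpleGraph n → ℕ → Set
HasTreewidth G k =
  (Σ (TreeDecomposition G) λ D → WidthAtMost D k) ×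
  (∀ w (D : TreeDecomposition G) → WidthAtMost D w → k ≤ w)

-- An answer to a CC query S: the partition of S into components of G[S],
-- encoded as the "same component" relation on S (false outside S).
Answer : ℕ → Set
Answer n = Fin n → Fin n → Bool

record CCOracle {n : ℕ} (G : SimpleGraph n) : Set where
  field
    ans   : Subset n → Answer n
    sound : ∀ S u v → ans S u v ≡ true → ConnectedIn G S u v
    compl : ∀ S u v → ConnectedIn G S u v → ans S u v ≡ true
open CCOracle public

-- Adaptive deterministic query strategy: ask a set, branch on the answer,
-- eventually output an edge set (adjacency function).
data QueryTree (n : ℕ) : Set where
  output : (Fin n → Fin n → Bool) → QueryTree n
  ask    : Subset n → (Answer n → QueryTree n) → QueryTree n

run : ∀ {n} → (Subset n → Answer n) → QueryTree n → (Fin n → Fin n → Bool) × ℕ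
run o (output E) = E , 0
run o (ask S k) with run o (k (o S))
... | E , q = E , suc q

-- A randomized adaptive algorithm: on input n and the treewidth k it uses
-- bits n k uniformly random bits, and for each bit string follows a query tree.
record RandomizedAlgorithm : Set where
  field
    bits : ℕ → ℕ → ℕ
    alg  : (n k : ℕ) → Vec Bool (bits n k) → QueryTree n
open RandomizedAlgorithm public

allBits : (r : ℕ) → List (Vec Bool r)
allBits zero = [] ∷ []
allBits (suc r) = map (true ∷_) (allBits r) ++ map (false ∷_) (allBits r)

CorrectOutput : ∀ {n} → SimpleGraph n → (Fin n → Fin n → Bool) → Set
CorrectOutput G E = ∀ u v → E u v ≡ adj G u v

correct? : ∀ {n} (G : SimpleGraph n) (E : Fin n → Fin n → Bool) → Dec (CorrectOutput G E)
correct? G E = all? (λ u → all? (λ v → E u v ≟ᵇ adj G u v))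

failureCount : (A : RandomizedAlgorithm) {n : ℕ} (k : ℕ) (G : SimpleGraph n) → CCOracle G → ℕ
failureCount A {n} k G o =
  length (filter (λ b → ¬? (correct? G (proj₁ (run (ans o) (alg A n k b))))) (allBits (bits A n k)))

queriesUsed : (A : RandomizedAlgorithm) {n : ℕ} (k : ℕ) (G : SimpleGraph n) → CCOracle G →
              Vec Bool (bits A n k) → ℕ
queriesUsed A {n} k G o b = proj₂ (run (ans o) (alg A n k b))

module Submission where

open import Defs renaming (sym to adj-sym; irrefl to adj-irrefl)
open import Data.Nat using (ℕ; zero; suc; _≤_; _<_; _+_; _*_; _∸_; _^_; _≤?_; z≤n; s≤s; s≤s⁻¹; NonZero; ⌊_/2⌋; ⌈_/2⌉)
open import Data.Nat.Induction using (<-rec)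
open import Data.Nat.Logarithm using (⌈log₂_⌉; ⌈log₂⌉-mono-≤; ⌈log₂⌈n/2⌉⌉≡⌈log₂n⌉∸1)
open import Data.Nat.Properties hiding (_≟_; _<?_; <-cmp)
open import Data.Nat.Solver using (module +-*-Solver)
open import Data.Bool using (Bool; true; false; if_then_else_; _∧_; _∨_; not)
open import Data.Bool.ListAction using (any; all)
open import Data.Bool.Properties using (T-≡; ⇔→≡; ∨-zeroʳ) renaming (_≟_ to _≟ᵇ_)
open import Data.Empty using (⊥-elim)
open import Data.Fin using (Fin; zero; suc; toℕ; fromℕ; fromℕ<; inject₁; _≟_) renaming (_<_ to _<ᶠ_)
open import Data.Fin.Properties using (any?; all?; toℕ-injective; toℕ<n; toℕ-fromℕ<; <-cmp; _<?_)
open import Data.Fin.Subset using (Subset; _∈_; _∉_; _⊆_; ∣_∣; inside; outside; _∪_; _∩_; _-_; ⁅_⁆; ⋃; ⊤; ⊥)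
open import Data.Fin.Subset.Properties
  using (_∈?_; ∉⊥; ∣⊥∣≡0; ∣⊤∣≡n; ∣p∣≤n; x∈⁅x⁆; x∈⁅y⁆⇒x≡y; ∣⁅x⁆∣≡1; p⊆q⇒∣p∣≤∣q∣; p⊂q⇒∣p∣<∣q∣; p∩q⊆p; x∈p∩q⁺; x∈p∩q⁻;
         p⊆p∪q; q⊆p∪q; x∈p∪q⁺; x∈p∪q⁻; ∣q∣≤∣p∪q∣; p─q⊆p; x∈p∧x≢y⇒x∈p-y; x∈p⇒∣p-x∣<∣p∣)
open import Data.List as List using (List; []; _∷_; allFin; length; filter; cartesianProduct)
open import Data.List.Properties using (filter-++; length-++; length-map; length-tabulate; map-++; map-∘; map-id)
import Data.List.Membership.Propositional as L
open import Data.List.Membership.Propositional.Properties using (∈-allFin; ∈-cartesianProduct⁺)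
open import Data.List.Membership.DecPropositional using () renaming (_∈?_ to mem?)
open import Data.List.Relation.Unary.All as All using (All; []; _∷_)
open import Data.List.Relation.Unary.Any as Any using (Any; here; there)
open import Data.List.Relation.Unary.Any.Properties using (any⁺; any⁻; map⁺; map⁻)
open import Data.Product using (Σ; ∃; ∃₂; _×_; _,_; proj₁; proj₂)
open import Data.Sum using (_⊎_; inj₁; inj₂)
open import Data.Unit using () renaming (⊤ to Unit)
open import Data.Vec using (Vec; []; _∷_; _++_; take; drop; lookup; tabulate; here; there)
open import Data.Vec.Properties using (lookup∘tabulate; lookup⇒[]=; []=⇒lookup)
open import Data.Vec.Relation.Unary.All as VAll using ([]; _∷_)
open import Data.Vec.Relation.Unary.AllPairs using ([]; _∷_)
open import Data.Vec.Relation.Unary.Any as VAny using (here; there)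
open import Data.Vec.Relation.Unary.Unique.Propositional using (Unique)
open import Data.Vec.Relation.Unary.Unique.Propositional.Properties using (lookup-injective)
open import Function using (_∘_; case_of_; Equivalence; mk⇔)
open import Relation.Binary.Construct.Closure.ReflexiveTransitive as Star using (Star; ε; _◅_; _◅◅_)
open import Relation.Binary.Definitions using (tri<; tri≈; tri>)
open import Relation.Binary.PropositionalEquality using (_≡_; _≢_; refl; sym; trans; cong; cong₂; subst; subst₂)
open import Relation.Nullary using (¬_; Dec; yes; no; does; contradiction; ¬?; _×-dec_; _→-dec_)
open import Relation.Nullary.Decidable using (map′; dec-true; decidable-stable)

-- Phase one draws O(k² log n) random vertex sets, keeping each vertex with probability between 1/(4k) and
-- 1/(2k). Two vertices u, v sharing no bag are separated by a set W of at most k vertices, and a draw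
-- contains u and v but misses W with probability Ω(1/k²); a union bound shows that, with high probability,
-- every pair not seen separated by some answer (a candidate pair) shares a bag. Every edge is a candidate
-- pair.
-- Phase two searches exhaustively, without queries, for a vertex ranking and a (k+1)-colouring under which
-- candidate pairs differ in rank and colour and no vertex has two lower-ranked candidate partners of the
-- same colour. An elimination ordering of the tree decomposition provides one. Any two colour classes then
-- induce a forest of candidate pairs, so a single query on their union reveals which candidate pairs
-- between them are edges.

-- From tree decompositions to bag sequences

-- Carrying the visited vertices as a vector matches the function `vtx` of `Cycle` and lets
-- simplicity of a path be stated as `Unique`.
data Path {V : Set} (R : V → V → Set) : ∀ {ℓ} → Vec V (suc ℓ) → V → V → Set where
  [_]  : ∀ v → Path R (v ∷ []) v v
  _◅_ : ∀ {ℓ u w v} {vs : Vec V (suc ℓ)} → R u w → Path R vs w v → Path R (u ∷ vs) u v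

module _ {V : Set} {R : V → V → Set} where

  path-first : ∀ {ℓ u v} {vs : Vec V (suc ℓ)} → Path R vs u v → lookup vs zero ≡ u
  path-first [ v ] = refl
  path-first (r ◅ p) = refl

  path-last : ∀ {ℓ u v} {vs : Vec V (suc ℓ)} → Path R vs u v → lookup vs (fromℕ ℓ) ≡ v
  path-last [ v ] = refl
  path-last (r ◅ p) = path-last p

  path-step : ∀ {ℓ u v} {vs : Vec V (suc ℓ)} → Path R vs u v →
              ∀ (i : Fin ℓ) → R (lookup vs (inject₁ i)) (lookup vs (suc i))
  path-step (r ◅ p) zero    = subst (R _) (sym (path-first p)) r
  path-step (r ◅ p) (suc i) = path-step p i

SimplePath : {V : Set} (R : V → V → Set) → V → V → Set
SimplePath {V} R u v = ∃ λ ℓ → Σ (Vec V (suc ℓ)) λ vs → Path R vs u v × Unique vs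

suffix-from : ∀ {V : Set} {R : V → V → Set} {ℓ u w v} {vs : Vec V (suc ℓ)} →
              VAny.Any (u ≡_) vs → Path R vs w v → Unique vs → SimplePath R u v
suffix-from (here refl) [ v ]   un       = _ , _ , [ v ] , un
suffix-from (here refl) (r ◅ p) un       = _ , _ , r ◅ p , un
suffix-from (there u∈)  (r ◅ p) (_ ∷ un) = suffix-from u∈ p un

-- If the first vertex recurs on the simple path found for the rest of the walk, only the suffix
-- from that recurrence is kept.
loop-erasure : ∀ {m} {R : Fin m → Fin m → Set} {u v} → Star R u v → SimplePath R u v
loop-erasure ε = _ , _ , [ _ ] , [] ∷ []
loop-erasure (_◅_ {i = u} r rs) with loop-erasure rs
... | ℓ , vs , p , un with VAny.any? (u ≟_) vs
...   | yes u∈ = suffix-from u∈ p un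
...   | no  u∉ = _ , u ∷ vs , r ◅ p , fresh vs u∉ ∷ un
  where
  fresh : ∀ {k} (xs : Vec _ k) → ¬ VAny.Any (u ≡_) xs → VAll.All (u ≢_) xs
  fresh []       _  = []
  fresh (x ∷ xs) u∉ = (u∉ ∘ here) ∷ fresh xs (u∉ ∘ there)

∈-start : ∀ {m a} {P : Fin m → Set} {s t} → Walk a P s t → P s
∈-start (here p)     = p
∈-start (step p _ _) = p

walk⇒star : ∀ {m} {a : Fin m → Fin m → Bool} {P : Fin m → Set} {R : Fin m → Fin m → Set} →
            (∀ {s t} → P s → P t → a s t ≡ true → R s t) → ∀ {s t} → Walk a P s t → Star R s t
walk⇒star f (here _)     = ε
walk⇒star f (step p e w) = f p (∈-start w) e ◅ walk⇒star f w

-- After loop erasure the walk is not a single vertex, as `b ≢ a`, nor a single step, as that step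
-- is forbidden. It has at least three distinct vertices, and the edge between `a` and `b` closes it
-- into a cycle.
no-detour : ∀ {m} (T : SimpleGraph m) → ¬ Cycle T → ∀ {a b} → b ≢ a → adj T a b ≡ true →
            ¬ Star (λ s t → adj T s t ≡ true × ¬ (s ≡ b × t ≡ a)) b a
no-detour T acyclic {a} {b} b≢a ab walk with loop-erasure walk
... | _ , _ , [ _ ] , _ = b≢a refl
... | _ , _ , (_ , ne) ◅ [ _ ] , _ = ne (refl , refl)
... | suc (suc len) , vs , p@(_ ◅ (_ ◅ _)) , un = acyclic record
  { len   = len
  ; vtx   = lookup vs
  ; inj   = λ {i} {j} → lookup-injective un i j
  ; edges = λ i → proj₁ (path-step p i)
  ; close = subst (λ z → adj T z b ≡ true) (sym (path-last p)) ab
  }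

-- The adjacency, with loops, of the graph in which every bag is made a clique.
Share : ∀ {n} → List (Subset n) → Fin n → Fin n → Set
Share bs x y = Any (λ b → x ∈ b × y ∈ b) bs

Occurs : ∀ {n} → List (Subset n) → Fin n → Set
Occurs bs x = Any (x ∈_) bs

-- Weak running intersection: what a new bag shares with the older ones is already pairwise joined.
data RunningIntersection {n : ℕ} : List (Subset n) → Set where
  []  : RunningIntersection []
  _∷_ : ∀ {b bs} → (∀ {x y} → x ∈ b → y ∈ b → Occurs bs x → Occurs bs y → Share bs x y) →
        RunningIntersection bs → RunningIntersection (b ∷ bs)

module _ {n : ℕ} {G : SimpleGraph n} (D : TreeDecomposition G) where

  private
    Node : Set
    Node = Fin (suc (nodes D))

  -- Invariant of a traversal of the decomposition tree, visited nodes listed newest first.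
  -- Connectivity among the visited nodes supplies one half of the detour that rules out a badly
  -- attached bag.
  record Explored (ts : List Node) : Set where
    field
      connected : ∀ {s t} → s L.∈ ts → t L.∈ ts →
                  Star (λ s t → adj (T D) s t ≡ true × s L.∈ ts × t L.∈ ts) s t
      running   : RunningIntersection (List.map (bag D) ts)
  open Explored

  explored-root : Explored (zero ∷ [])
  explored-root = record
    { connected = λ { (here refl) (here refl) → ε }
    ; running   = (λ _ _ ()) ∷ []
    }

  -- A vertex of the bag at `b` that occurs in a visited bag must lie in the bag at `a`, so any two
  -- such vertices share that older bag.
  explore-edge : ∀ {a b ts} → Explored ts → a L.∈ ts → ¬ (b L.∈ ts) → adj (T D) a b ≡ true →
                 Explored (b ∷ ts)
  explore-edge {a} {b} {ts} ex a∈ b∉ ab = record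
    { connected = conn
    ; running   = (λ {x} {y} xb yb xo yo → map⁺ (L.lose a∈ (attached xb xo , attached yb yo)))
                  ∷ running ex
    }
    where
    R′ : Node → Node → Set
    R′ s t = adj (T D) s t ≡ true × s L.∈ b ∷ ts × t L.∈ b ∷ ts

    weaken : ∀ {s t} → s L.∈ ts → t L.∈ ts → Star R′ s t
    weaken s∈ t∈ = Star.map (λ (e , p , q) → e , there p , there q) (connected ex s∈ t∈)

    conn : ∀ {s t} → s L.∈ b ∷ ts → t L.∈ b ∷ ts → Star R′ s t
    conn (here refl) (here refl) = ε
    conn (here refl) (there t∈)  =
      (trans (adj-sym (T D) b a) ab , here refl , there a∈) ◅ weaken a∈ t∈
    conn (there s∈)  (here refl) = weaken s∈ a∈ ◅◅ (ab , there a∈ , here refl) ◅ ε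
    conn (there s∈)  (there t∈)  = weaken s∈ t∈

    b≢a : b ≢ a
    b≢a refl = b∉ a∈

    attached : ∀ {x} → x ∈ bag D b → Occurs (List.map (bag D) ts) x → x ∈ bag D a
    attached {x} xb xo with x ∈? bag D a
    ... | yes xa = xa
    ... | no  xa∉ with L.find (map⁻ xo)
    -- The walk through bags containing `x` never meets `a`, and the walk among visited nodes never
    -- meets `b`, so their concatenation avoids the step from `b` to `a`.
    ...   | s , s∈ , xs = ⊥-elim (no-detour (T D) (proj₂ (tree D)) b≢a ab
      (walk⇒star (λ { _ xt e → e , λ { (_ , refl) → xa∉ xt } }) (coherent D x b s xb xs)
       ◅◅ Star.map (λ (e , p , _) → e , λ { (refl , _) → b∉ p }) (connected ex s∈ a∈)))

  explore-walk : ∀ {ts u t} → Explored ts → u L.∈ ts → Walk (adj (T D)) (λ _ → Unit) u t →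
                 ∃ λ ts′ → Explored ts′ × (∀ {s} → s L.∈ ts → s L.∈ ts′) × t L.∈ ts′
  explore-walk ex u∈ (here _) = _ , ex , (λ p → p) , u∈
  explore-walk {ts} ex u∈ (step {w = w} _ e walk) with mem? _≟_ w ts
  ... | yes w∈ = explore-walk ex w∈ walk
  ... | no  w∉ with explore-walk (explore-edge ex u∈ w∉ e) (here refl) walk
  ...   | ts′ , ex′ , sub , t∈ = ts′ , ex′ , sub ∘ there , t∈

  explore-all : ∀ (targets : List Node) → ∃ λ ts → Explored ts × zero L.∈ ts × All (L._∈ ts) targets
  explore-all [] = _ , explored-root , here refl , []
  explore-all (t ∷ targets) with explore-all targets
  ... | ts , ex , r∈ , all with explore-walk ex r∈ (proj₁ (tree D) zero t)
  ...   | ts′ , ex′ , sub , t∈ = ts′ , ex′ , sub r∈ , t∈ ∷ All.map sub all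

  -- Listing the bags in order of discovery discards the tree; everything about bags below is an
  -- induction on this list.
  bag-sequence : ∀ {w} → WidthAtMost D w → ∃ λ bs → RunningIntersection bs × All (λ b → ∣ b ∣ ≤ suc w) bs ×
                 (∀ v → Occurs bs v) × (∀ {u v} → adj G u v ≡ true → Share bs u v)
  bag-sequence wd with explore-all (allFin _)
  ... | ts , ex , _ , all =
    List.map (bag D) ts , running ex , All-map ts
    , (λ v → case cover D v of λ { (t , p) → map⁺ (L.lose (reached t) p) })
    , (λ {u} {v} e → case edgeCover D u v e of λ { (t , p) → map⁺ (L.lose (reached t) p) })
    where
    reached : ∀ t → t L.∈ ts
    reached t = All.lookup all (∈-allFin t)
    All-map : ∀ ss → All (λ b → ∣ b ∣ ≤ suc _) (List.map (bag D) ss)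
    All-map []       = []
    All-map (s ∷ ss) = wd s ∷ All-map ss

-- Separators and elimination orderings

∣p∪q∣≤∣p∣+∣q∣ : ∀ {n} (p q : Subset n) → ∣ p ∪ q ∣ ≤ ∣ p ∣ + ∣ q ∣
∣p∪q∣≤∣p∣+∣q∣ [] [] = z≤n
∣p∪q∣≤∣p∣+∣q∣ (outside ∷ p) (outside ∷ q) = ∣p∪q∣≤∣p∣+∣q∣ p q
∣p∪q∣≤∣p∣+∣q∣ (outside ∷ p) (inside ∷ q) rewrite +-suc ∣ p ∣ ∣ q ∣ = s≤s (∣p∪q∣≤∣p∣+∣q∣ p q)
∣p∪q∣≤∣p∣+∣q∣ (inside ∷ p) (outside ∷ q) = s≤s (∣p∪q∣≤∣p∣+∣q∣ p q)
∣p∪q∣≤∣p∣+∣q∣ (inside ∷ p) (inside ∷ q) =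
  s≤s (≤-trans (∣p∪q∣≤∣p∣+∣q∣ p q) (+-monoʳ-≤ ∣ p ∣ (n≤1+n ∣ q ∣)))

occurs? : ∀ {n} (bs : List (Subset n)) x → Dec (Occurs bs x)
occurs? bs x = Any.any? (x ∈?_) bs

share? : ∀ {n} (bs : List (Subset n)) x y → Dec (Share bs x y)
share? bs x y = Any.any? (λ b → x ∈? b ×-dec y ∈? b) bs

share⇒occursˡ : ∀ {n} {bs : List (Subset n)} {x y} → Share bs x y → Occurs bs x
share⇒occursˡ = Any.map proj₁

share⇒occursʳ : ∀ {n} {bs : List (Subset n)} {x y} → Share bs x y → Occurs bs y
share⇒occursʳ = Any.map proj₂

-- Separation is witnessed by a two-valued `side`, not by the absence of walks, so that adding a bag
-- only requires extending a function.
record Separation {n} (bs : List (Subset n)) (w : ℕ) (u v : Fin n) : Set where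
  field
    separator : Subset n
    size      : ∣ separator ∣ ≤ w
    u∉        : u ∉ separator
    v∉        : v ∉ separator
    side      : Fin n → Bool
    constant  : ∀ {x y} → Share bs x y → x ∉ separator → y ∉ separator → side x ≡ side y
    apart     : side u ≢ side v
open Separation public

separation-sym : ∀ {n bs w} {u v : Fin n} → Separation bs w u v → Separation bs w v u
separation-sym s = record
  { separator = separator s ; size = size s ; u∉ = v∉ s ; v∉ = u∉ s
  ; side = side s ; constant = constant s ; apart = apart s ∘ sym }

-- A vertex that occurs in the newest bag only is cut off by the rest of that bag.
separate-new : ∀ {n w b} {bs : List (Subset n)} {u v} → ∣ b ∣ ≤ suc w → u ∈ b → ¬ Occurs bs u → v ∉ b →
               Separation (b ∷ bs) w u v
separate-new {b = b} {bs} {u} {v} ∣b∣≤ u∈b u-new v∉b = record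
  { separator = b - u
  ; size      = s≤s⁻¹ (<-≤-trans (x∈p⇒∣p-x∣<∣p∣ u∈b) ∣b∣≤)
  ; u∉        = λ u∈ → x∉p-x b u∈
  ; v∉        = v∉b ∘ p─q⊆p b ⁅ u ⁆
  ; side      = λ x → does (x ≟ u)
  ; constant  = const
  ; apart     = ap
  }
  where
  x∉p-x : ∀ {n} (p : Subset n) {x} → x ∉ p - x
  x∉p-x (s ∷ p) {zero}  ()
  x∉p-x (s ∷ p) {suc x} (there x∈) = x∉p-x p x∈
  only-u : ∀ {x} → x ∈ b → x ∉ b - u → x ≡ u
  only-u {x} x∈ x∉ = decidable-stable (x ≟ u) λ x≢u → x∉ (x∈p∧x≢y⇒x∈p-y x∈ x≢u)
  const : ∀ {x y} → Share (b ∷ bs) x y → x ∉ b - u → y ∉ b - u → does (x ≟ u) ≡ does (y ≟ u)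
  const (here (xb , yb)) x∉ y∉ rewrite only-u xb x∉ | only-u yb y∉ = refl
  const {x} {y} (there sh) x∉ y∉ with x ≟ u | y ≟ u
  ... | yes refl | _        = contradiction (share⇒occursˡ sh) u-new
  ... | no _     | yes refl = contradiction (share⇒occursʳ sh) u-new
  ... | no _     | no _     = refl
  ap : does (u ≟ u) ≢ does (v ≟ u)
  ap with u ≟ u | v ≟ u
  ... | yes _  | yes refl = contradiction u∈b v∉b
  ... | yes _  | no _     = λ ()
  ... | no u≢u | _        = contradiction refl u≢u

-- New vertices of a bag all join the side of the old part of that bag.
separate-old : ∀ {n w b} {bs : List (Subset n)} {u v} →
               (∀ {x y} → x ∈ b → y ∈ b → Occurs bs x → Occurs bs y → Share bs x y) →
               Occurs bs u → Occurs bs v → Separation bs w u v → Separation (b ∷ bs) w u v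
separate-old {b = b} {bs} {u} {v} joined uo vo s = record
  { separator = separator s ; size = size s ; u∉ = u∉ s ; v∉ = v∉ s
  ; side     = side′
  ; constant = const
  ; apart    = λ eq → apart s (trans (sym (side-old uo)) (trans eq (side-old vo)))
  }
  where
  Old : Fin _ → Set
  Old y = y ∈ b × y ∉ separator s × Occurs bs y
  old? : Dec (∃ Old)
  old? = any? λ y → y ∈? b ×-dec ¬? (y ∈? separator s) ×-dec occurs? bs y
  default : Dec (∃ Old) → Bool
  default (yes (y , _)) = side s y
  -- An arbitrary value: in this case every vertex of `b` outside the separator is new, and these
  -- only have to agree with one another.
  default (no _)        = true
  side′ : Fin _ → Bool
  side′ x = if does (occurs? bs x) then side s x else default old?
  side-old : ∀ {x} → Occurs bs x → side′ x ≡ side s x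
  side-old {x} xo with occurs? bs x
  ... | yes _  = refl
  ... | no ¬xo = contradiction xo ¬xo
  old≡default : ∀ {x} (d : Dec (∃ Old)) → Old x → side s x ≡ default d
  old≡default (yes (y , yb , y∉ , yo)) (xb , x∉ , xo) = constant s (joined xb yb xo yo) x∉ y∉
  old≡default (no none) old = contradiction (_ , old) none
  const : ∀ {x y} → Share (b ∷ bs) x y → x ∉ separator s → y ∉ separator s → side′ x ≡ side′ y
  const (there sh) x∉ y∉ =
    trans (side-old (share⇒occursˡ sh)) (trans (constant s sh x∉ y∉) (sym (side-old (share⇒occursʳ sh))))
  const {x} {y} (here (xb , yb)) x∉ y∉ with occurs? bs x | occurs? bs y
  ... | yes xo | yes yo = constant s (joined xb yb xo yo) x∉ y∉
  ... | yes xo | no _   = old≡default old? (xb , x∉ , xo)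
  ... | no _   | yes yo = sym (old≡default old? (yb , y∉ , yo))
  ... | no _   | no _   = refl

-- Bags are peeled off, newest first, until `u` or `v` is new. The new one then lies in the newest
-- bag only, the other does not lie in it, and the rest of that bag, at most `w` vertices, separates
-- them.
separation : ∀ {n w} {bs : List (Subset n)} → RunningIntersection bs → All (λ b → ∣ b ∣ ≤ suc w) bs →
             ∀ {u v} → Occurs bs u → Occurs bs v → ¬ Share bs u v → Separation bs w u v
separation {bs = b ∷ bs} (joined ∷ ri) (∣b∣≤ ∷ ∣bs∣≤) {u} {v} uo vo ¬sh with occurs? bs u | occurs? bs v
... | yes uo′ | yes vo′ = separate-old joined uo′ vo′ (separation ri ∣bs∣≤ uo′ vo′ (¬sh ∘ there))
... | no u-new | _ =
  separate-new ∣b∣≤ (Any.head u-new uo) u-new λ vb → ¬sh (here (Any.head u-new uo , vb))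
... | yes _ | no v-new =
  separation-sym (separate-new ∣b∣≤ (Any.head v-new vo) v-new λ ub → ¬sh (here (ub , Any.head v-new vo)))

image : ∀ {m n} → (Fin n → Fin m) → Subset n → Subset m
image f []            = ⊥
image f (outside ∷ p) = image (f ∘ suc) p
image f (inside ∷ p)  = ⁅ f zero ⁆ ∪ image (f ∘ suc) p

∈-image : ∀ {m n} (f : Fin n → Fin m) {p : Subset n} {x} → x ∈ p → f x ∈ image f p
∈-image f {inside ∷ p} here = x∈p∪q⁺ (inj₁ (x∈⁅x⁆ (f zero)))
∈-image f {outside ∷ p} (there x∈) = ∈-image (f ∘ suc) x∈
∈-image f {inside ∷ p} (there x∈) = x∈p∪q⁺ {p = ⁅ f zero ⁆} (inj₂ (∈-image (f ∘ suc) x∈))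

∣image∣≤ : ∀ {m n} (f : Fin n → Fin m) (p : Subset n) → ∣ image f p ∣ ≤ ∣ p ∣
∣image∣≤ {m} f [] = ≤-reflexive (∣⊥∣≡0 m)
∣image∣≤ f (outside ∷ p) = ∣image∣≤ (f ∘ suc) p
∣image∣≤ f (inside ∷ p) = begin
  ∣ ⁅ f zero ⁆ ∪ image (f ∘ suc) p ∣       ≤⟨ ∣p∪q∣≤∣p∣+∣q∣ ⁅ f zero ⁆ _ ⟩
  ∣ ⁅ f zero ⁆ ∣ + ∣ image (f ∘ suc) p ∣   ≡⟨ cong (_+ ∣ image (f ∘ suc) p ∣) (∣⁅x⁆∣≡1 (f zero)) ⟩
  suc ∣ image (f ∘ suc) p ∣                ≤⟨ s≤s (∣image∣≤ (f ∘ suc) p) ⟩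
  suc ∣ p ∣                                ∎
  where open ≤-Reasoning

missing : ∀ {n} (p : Subset n) → ∣ p ∣ < n → ∃ λ x → x ∉ p
missing {n} p ∣p∣<n with any? (λ x → ¬? (x ∈? p))
... | yes found = found
... | no none = contradiction (subst (_≤ ∣ p ∣) (∣⊤∣≡n n) (p⊆q⇒∣p∣≤∣q∣ full)) (<⇒≱ ∣p∣<n)
  where
  full : ⊤ ⊆ p
  full {x} _ = decidable-stable (x ∈? p) λ x∉ → none (x , x∉)

InjectiveOn : ∀ {m n} → (Fin n → Fin m) → Subset n → Set
InjectiveOn c p = ∀ {x y} → x ∈ p → y ∈ p → c x ≡ c y → x ≡ y

-- Greedy colouring of `b` outside `s`: when a vertex is reached, the vertices of `b` coloured so
-- far number at most `w`, so one of the `suc w` colours is free.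
recolour : ∀ {n w} {b s : Subset n} → ∣ b ∣ ≤ suc w → s ⊆ b → (c : Fin n → Fin (suc w)) → InjectiveOn c s →
           ∃ λ (c′ : Fin n → Fin (suc w)) → InjectiveOn c′ b × (∀ {x} → (x ∈ b → x ∈ s) → c′ x ≡ c x)
recolour {n} {w} {b} {s} ∣b∣≤ s⊆b c inj =
  let c′ , t , _ , _ , inj′ , all , agree = go (allFin n) in
  c′ , (λ xb yb → inj′ (All.lookup all (∈-allFin _) xb) (All.lookup all (∈-allFin _) yb)) , agree
  where
  go : ∀ xs → ∃₂ λ (c′ : Fin n → Fin (suc w)) t → s ⊆ t × t ⊆ b × InjectiveOn c′ t ×
       All (λ x → x ∈ b → x ∈ t) xs × (∀ {x} → (x ∈ b → x ∈ s) → c′ x ≡ c x)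
  go [] = c , s , (λ p → p) , s⊆b , inj , [] , λ _ → refl
  go (z ∷ xs) with go xs
  ... | c′ , t , s⊆t , t⊆b , inj′ , all , agree with z ∈? b | z ∈? t
  ...   | no z∉b  | _       = c′ , t , s⊆t , t⊆b , inj′ , (λ zb → contradiction zb z∉b) ∷ all , agree
  ...   | yes _   | yes z∈t = c′ , t , s⊆t , t⊆b , inj′ , (λ _ → z∈t) ∷ all , agree
  ...   | yes z∈b | no z∉t  =
    c″ , t ∪ ⁅ z ⁆ , p⊆p∪q ⁅ z ⁆ ∘ s⊆t , t′⊆b , inj″ ,
    (λ _ → x∈p∪q⁺ (inj₂ (x∈⁅x⁆ z))) ∷ All.map (λ f xb → p⊆p∪q ⁅ z ⁆ (f xb)) all ,
    λ {x} f → trans (c″-old (λ { refl → z∉t (s⊆t (f z∈b)) })) (agree f)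
    where
    ∣t∣≤w : ∣ t ∣ ≤ w
    ∣t∣≤w = ≤-trans (p⊆q⇒∣p∣≤∣q∣ {q = b - z} λ {x} xt → x∈p∧x≢y⇒x∈p-y (t⊆b xt) λ { refl → z∉t xt })
                    (s≤s⁻¹ (<-≤-trans (x∈p⇒∣p-x∣<∣p∣ z∈b) ∣b∣≤))
    free : ∃ λ k → k ∉ image c′ t
    free = missing (image c′ t) (s≤s (≤-trans (∣image∣≤ c′ t) ∣t∣≤w))
    c″ : Fin n → Fin (suc w)
    c″ x = if does (x ≟ z) then proj₁ free else c′ x
    c″-old : ∀ {x} → x ≢ z → c″ x ≡ c′ x
    c″-old {x} x≢z with x ≟ z
    ... | yes x≡z = contradiction x≡z x≢z
    ... | no _    = refl
    t′⊆b : t ∪ ⁅ z ⁆ ⊆ b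
    t′⊆b {x} x∈ with x∈p∪q⁻ t ⁅ z ⁆ x∈
    ... | inj₁ x∈t = t⊆b x∈t
    ... | inj₂ x∈z rewrite x∈⁅y⁆⇒x≡y z x∈z = z∈b
    old : ∀ {x} → x ∈ t ∪ ⁅ z ⁆ → x ≢ z → x ∈ t
    old x∈ x≢z with x∈p∪q⁻ t ⁅ z ⁆ x∈
    ... | inj₁ x∈t = x∈t
    ... | inj₂ x∈z = contradiction (x∈⁅y⁆⇒x≡y z x∈z) x≢z
    inj″ : InjectiveOn c″ (t ∪ ⁅ z ⁆)
    inj″ {x} {y} x∈ y∈ eq with x ≟ z | y ≟ z
    ... | yes x≡z | yes y≡z = trans x≡z (sym y≡z)
    ... | no x≢z  | no y≢z  = inj′ (old x∈ x≢z) (old y∈ y≢z) eq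
    ... | yes _   | no y≢z  = contradiction (subst (_∈ image c′ t) (sym eq) (∈-image c′ (old y∈ y≢z))) (proj₂ free)
    ... | no x≢z  | yes _   = contradiction (subst (_∈ image c′ t) eq (∈-image c′ (old x∈ x≢z))) (proj₂ free)

occurs⇒∈⋃ : ∀ {n} {bs : List (Subset n)} {x} → Occurs bs x → x ∈ ⋃ bs
occurs⇒∈⋃ (here xb) = x∈p∪q⁺ (inj₁ xb)
occurs⇒∈⋃ {bs = b ∷ _} (there xo) = x∈p∪q⁺ {p = b} (inj₂ (occurs⇒∈⋃ xo))

∈⋃⇒occurs : ∀ {n} (bs : List (Subset n)) {x} → x ∈ ⋃ bs → Occurs bs x
∈⋃⇒occurs [] x∈ = ⊥-elim (∉⊥ x∈)
∈⋃⇒occurs (b ∷ bs) x∈ with x∈p∪q⁻ b (⋃ bs) x∈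
... | inj₁ xb = here xb
... | inj₂ xo = there (∈⋃⇒occurs bs xo)

-- A perfect elimination ordering of the sharing graph together with a proper colouring.
record Elimination {n} (bs : List (Subset n)) (w : ℕ) : Set where
  field
    rank      : Fin n → ℕ
    colour    : Fin n → Fin (suc w)
    rank<     : ∀ {x} → Occurs bs x → rank x < ∣ ⋃ bs ∣ * n
    rank-inj  : ∀ {x y} → Share bs x y → rank x ≡ rank y → x ≡ y
    proper    : ∀ {x y} → Share bs x y → colour x ≡ colour y → x ≡ y
    clique    : ∀ {v x y} → Share bs v x → Share bs v y → rank x < rank v → rank y < rank v → Share bs x y

-- The new vertices of the newest bag come last. All partners of a new vertex lie in that bag. The
-- lower-ranked partners of an old vertex are old, and old vertices that meet in the new bag already
-- share an older one.
elimination : ∀ {n w} {bs : List (Subset n)} → RunningIntersection bs → All (λ b → ∣ b ∣ ≤ suc w) bs →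
              Elimination bs w
elimination [] [] = record
  { rank = λ _ → 0 ; colour = λ _ → zero ; rank< = λ () ; rank-inj = λ () ; proper = λ () ; clique = λ () }
elimination {n} {w} {b ∷ bs} (joined ∷ ri) (∣b∣≤ ∷ ∣bs∣≤) = record
  { rank     = rank′
  ; colour   = colour′
  ; rank<    = bound
  ; rank-inj = rank-inj′
  ; proper   = proper′
  ; clique   = clique′
  }
  where
  open Elimination (elimination ri ∣bs∣≤)
  u : ℕ
  u = ∣ ⋃ bs ∣ * n
  rank′ : Fin n → ℕ
  -- New vertices take ranks in a fresh block of length `n`, above all old ranks. A block is opened
  -- only when the union of the bags grows, which pays for the bound `∣ ⋃ bs ∣ * n`.
  rank′ x = if does (occurs? bs x) then rank x else u + toℕ x
  rank-old : ∀ {x} → Occurs bs x → rank′ x ≡ rank x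
  rank-old {x} xo with occurs? bs x
  ... | yes _  = refl
  ... | no ¬xo = contradiction xo ¬xo
  rank-new : ∀ {x} → ¬ Occurs bs x → rank′ x ≡ u + toℕ x
  rank-new {x} xn with occurs? bs x
  ... | yes xo = contradiction xo xn
  ... | no _   = refl
  old-below : ∀ {v x} → Occurs bs v → rank′ x < rank′ v → Occurs bs x
  old-below {v} {x} vo lt = decidable-stable (occurs? bs x) λ xn → n≮n u (begin-strict
    u            ≤⟨ m≤m+n u (toℕ x) ⟩
    u + toℕ x    ≡⟨ rank-new xn ⟨
    rank′ x      <⟨ lt ⟩
    rank′ v      ≡⟨ rank-old vo ⟩
    rank v       <⟨ rank< vo ⟩
    u            ∎)
    where open ≤-Reasoning
  old-share : ∀ {x y} → Occurs bs x → Occurs bs y → Share (b ∷ bs) x y → Share bs x y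
  old-share xo yo (here (xb , yb)) = joined xb yb xo yo
  old-share xo yo (there sh)       = sh
  old≢new : ∀ {x y} → Occurs bs x → ¬ Occurs bs y → rank′ x ≢ rank′ y
  old≢new {x} {y} xo yn eq = <⇒≢ (<-≤-trans (rank< xo) (m≤m+n u (toℕ y)))
    (trans (sym (rank-old xo)) (trans eq (rank-new yn)))
  bound : ∀ {x} → Occurs (b ∷ bs) x → rank′ x < ∣ b ∪ ⋃ bs ∣ * n
  bound {x} xo′ with occurs? bs x
  ... | yes xo = <-≤-trans (rank< xo) (*-monoˡ-≤ n (∣q∣≤∣p∪q∣ b (⋃ bs)))
  ... | no xn  = begin-strict
    u + toℕ x               <⟨ +-monoʳ-< u (toℕ<n x) ⟩
    u + n                   ≡⟨ +-comm u n ⟩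
    suc ∣ ⋃ bs ∣ * n        ≤⟨ *-monoˡ-≤ n (p⊂q⇒∣p∣<∣q∣ (q⊆p∪q b (⋃ bs) , x , x∈p∪q⁺ (inj₁ (Any.head xn xo′)) , xn ∘ ∈⋃⇒occurs bs)) ⟩
    ∣ b ∪ ⋃ bs ∣ * n        ∎
    where open ≤-Reasoning
  rank-inj′ : ∀ {x y} → Share (b ∷ bs) x y → rank′ x ≡ rank′ y → x ≡ y
  rank-inj′ {x} {y} sh eq = case occurs? bs x , occurs? bs y of λ
    { (yes xo , yes yo) → rank-inj (old-share xo yo sh) (trans (sym (rank-old xo)) (trans eq (rank-old yo)))
    ; (yes xo , no yn)  → contradiction eq (old≢new xo yn)
    ; (no xn , yes yo)  → contradiction (sym eq) (old≢new yo xn)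
    ; (no xn , no yn)   →
        toℕ-injective (+-cancelˡ-≡ u _ _ (trans (sym (rank-new xn)) (trans eq (rank-new yn))))
    }
  old-inj : InjectiveOn colour (b ∩ ⋃ bs)
  old-inj x∈ y∈ with x∈p∩q⁻ b (⋃ bs) x∈ | x∈p∩q⁻ b (⋃ bs) y∈
  ... | xb , xo | yb , yo = proper (joined xb yb (∈⋃⇒occurs bs xo) (∈⋃⇒occurs bs yo))
  recoloured : ∃ λ (c′ : Fin n → Fin (suc w)) → InjectiveOn c′ b × (∀ {x} → (x ∈ b → x ∈ b ∩ ⋃ bs) → c′ x ≡ colour x)
  recoloured = recolour ∣b∣≤ (p∩q⊆p b (⋃ bs)) colour old-inj
  colour′ : Fin n → Fin (suc w)
  colour′ = proj₁ recoloured
  colour-old : ∀ {x} → Occurs bs x → colour′ x ≡ colour x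
  colour-old xo = proj₂ (proj₂ recoloured) λ xb → x∈p∩q⁺ (xb , occurs⇒∈⋃ xo)
  proper′ : ∀ {x y} → Share (b ∷ bs) x y → colour′ x ≡ colour′ y → x ≡ y
  proper′ (here (xb , yb)) eq = proj₁ (proj₂ recoloured) xb yb eq
  proper′ (there sh) eq = proper sh
    (trans (sym (colour-old (share⇒occursˡ sh))) (trans eq (colour-old (share⇒occursʳ sh))))
  clique′ : ∀ {v x y} → Share (b ∷ bs) v x → Share (b ∷ bs) v y → rank′ x < rank′ v → rank′ y < rank′ v → Share (b ∷ bs) x y
  clique′ {v} {x} {y} vx vy x<v y<v = case occurs? bs v of λ
    { (yes vo) → there (clique
        (old-share vo (old-below vo x<v) vx) (old-share vo (old-below vo y<v) vy)
        (lower vo x<v) (lower vo y<v))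
    ; (no vn) → here (newest vn vx , newest vn vy)
    }
    where
    lower : ∀ {z} → Occurs bs v → rank′ z < rank′ v → rank z < rank v
    lower vo z<v = subst₂ _<_ (rank-old (old-below vo z<v)) (rank-old vo) z<v
    newest : ∀ {z} → ¬ Occurs bs v → Share (b ∷ bs) v z → z ∈ b
    newest vn (here (_ , zb)) = zb
    newest vn (there sh)      = contradiction (share⇒occursˡ sh) vn

-- Decoding the answers

-- The finite certificate sought in phase two. Orienting `H` towards lower ranks, each vertex has at
-- most one parent in each colour.
record Layered {n M K} (H : Fin n → Fin n → Bool) (r : Fin n → Fin M) (c : Fin n → Fin K) : Set where
  constructor layered
  field
    differ : ∀ u v → H u v ≡ true → r u ≢ r v × c u ≢ c v
    parent : ∀ v x y → H v x ≡ true → H v y ≡ true → r x <ᶠ r v → r y <ᶠ r v → c x ≡ c y → x ≡ y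
open Layered public

layered? : ∀ {n M K} (H : Fin n → Fin n → Bool) (r : Fin n → Fin M) (c : Fin n → Fin K) → Dec (Layered H r c)
layered? H r c = map′ (λ (d , p) → layered d p) (λ l → differ l , parent l)
  ((all? λ u → all? λ v → (H u v ≟ᵇ true) →-dec (¬? (r u ≟ r v) ×-dec ¬? (c u ≟ c v)))
   ×-dec
   (all? λ v → all? λ x → all? λ y → (H v x ≟ᵇ true) →-dec (H v y ≟ᵇ true) →-dec (r x <? r v) →-dec
     (r y <? r v) →-dec (c x ≟ c y) →-dec (x ≟ y)))

anyVec? : ∀ {M} n {P : Vec (Fin M) n → Set} → (∀ xs → Dec (P xs)) → Dec (∃ P)
anyVec? zero    P? = map′ (λ p → [] , p) (λ { ([] , p) → p }) (P? [])
anyVec? (suc n) P? = map′ (λ (x , xs , p) → x ∷ xs , p) (λ { (x ∷ xs , p) → x , xs , p })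
  (any? λ x → anyVec? n λ xs → P? (x ∷ xs))

-- Ranks and colours are vectors, so that exhaustive search over them is a plain recursion on the
-- length.
Layering : ∀ {n} (M K : ℕ) (H : Fin n → Fin n → Bool) → Set
Layering {n} M K H = ∃₂ λ (r : Vec (Fin M) n) (c : Vec (Fin K) n) → Layered H (lookup r) (lookup c)

layering? : ∀ {n} M K (H : Fin n → Fin n → Bool) → Dec (Layering M K H)
layering? M K H = anyVec? _ λ r → anyVec? _ λ c → layered? H (lookup r) (lookup c)

-- Two lower-ranked partners of a vertex share a bag by `clique`, so equal colours make them equal
-- by `proper`. Ranks stay below `n * n` since the union of the bags has at most `n` vertices.
elimination⇒layering : ∀ {n w} {bs : List (Subset n)} → Elimination bs w → (∀ x → Occurs bs x) →
                       {H : Fin n → Fin n → Bool} → (∀ {u v} → H u v ≡ true → u ≢ v × Share bs u v) →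
                       Layering (n * n) (suc w) H
elimination⇒layering {n} {w} {bs} el occ {H} H⊆ = tabulate r , tabulate colour , record
  { differ = λ u v h → (λ eq → proj₁ (H⊆ h) (rank-inj (proj₂ (H⊆ h))
                          (trans (sym (rank-r u)) (trans (cong toℕ eq) (rank-r v)))))
                     , (λ eq → proj₁ (H⊆ h) (proper (proj₂ (H⊆ h))
                          (trans (sym (lookup∘tabulate colour u)) (trans eq (lookup∘tabulate colour v)))))
  ; parent = λ v x y vx vy x<v y<v eq → proper
      (clique (proj₂ (H⊆ vx)) (proj₂ (H⊆ vy)) (subst₂ _<_ (rank-r x) (rank-r v) x<v)
              (subst₂ _<_ (rank-r y) (rank-r v) y<v))
      (trans (sym (lookup∘tabulate colour x)) (trans eq (lookup∘tabulate colour y)))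
  }
  where
  open Elimination el
  r : Fin n → Fin (n * n)
  r x = fromℕ< (<-≤-trans (rank< (occ x)) (*-monoˡ-≤ n (∣p∣≤n (⋃ bs))))
  rank-r : ∀ x → toℕ (lookup (tabulate r) x) ≡ rank x
  rank-r x = trans (cong toℕ (lookup∘tabulate r x)) (toℕ-fromℕ< _)

∈-tabulate⁺ : ∀ {n} {f : Fin n → Bool} {x} → f x ≡ true → x ∈ tabulate f
∈-tabulate⁺ {f = f} {x} eq = lookup⇒[]= x (tabulate f) (trans (lookup∘tabulate f x) eq)

∈-tabulate⁻ : ∀ {n} {f : Fin n → Bool} {x} → x ∈ tabulate f → f x ≡ true
∈-tabulate⁻ {f = f} {x} x∈ = trans (sym (lookup∘tabulate f x)) ([]=⇒lookup x∈)

bichromatic : ∀ {n K} → (Fin n → Fin K) → Fin K → Fin K → Subset n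
bichromatic c a b = tabulate λ x → does (c x ≟ a) ∨ does (c x ≟ b)

bichromaticˡ : ∀ {n K} (c : Fin n → Fin K) x {b} → x ∈ bichromatic c (c x) b
bichromaticˡ c x {b} = ∈-tabulate⁺ (cong (_∨ does (c x ≟ b)) (dec-true (c x ≟ c x) refl))

bichromaticʳ : ∀ {n K} (c : Fin n → Fin K) x {a} → x ∈ bichromatic c a (c x)
bichromaticʳ c x {a} = ∈-tabulate⁺
  (trans (cong (does (c x ≟ a) ∨_) (dec-true (c x ≟ c x) refl)) (∨-zeroʳ _))

bichromatic⁻ : ∀ {n K} (c : Fin n → Fin K) {a b x} → x ∈ bichromatic c a b → c x ≡ a ⊎ c x ≡ b
bichromatic⁻ c {a} {b} {x} x∈ with ∈-tabulate⁻ x∈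
... | eq with c x ≟ a | c x ≟ b
...   | yes p | _     = inj₁ p
...   | no _  | yes q = inj₂ q
bichromatic⁻ c x∈ | () | no _ | no _

module _ {n M K} {G : SimpleGraph n} {H : Fin n → Fin n → Bool} {r : Fin n → Fin M} {c : Fin n → Fin K}
         (lay : Layered H r c) (G⊆H : ∀ {x y} → adj G x y ≡ true → H x y ≡ true) (a b : Fin K) where

  private
    S : Subset n
    S = bichromatic c a b

  -- Only two colours occur in `S`, and both parents avoid the colour of `x`; hence they agree in
  -- colour and `parent` applies.
  unique-parent : ∀ {x y z} → x ∈ S → y ∈ S → z ∈ S → H x y ≡ true → H x z ≡ true → r y <ᶠ r x → r z <ᶠ r x → y ≡ z
  unique-parent {x} {y} {z} xS yS zS xy xz y<x z<x = parent lay x y z xy xz y<x z<x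
    (same (bichromatic⁻ c xS) (bichromatic⁻ c yS) (bichromatic⁻ c zS)
          (proj₂ (differ lay x y xy)) (proj₂ (differ lay x z xz)))
    where
    same : ∀ {p q s} → p ≡ a ⊎ p ≡ b → q ≡ a ⊎ q ≡ b → s ≡ a ⊎ s ≡ b → p ≢ q → p ≢ s → q ≡ s
    same _           (inj₁ refl) (inj₁ refl) _   _   = refl
    same _           (inj₂ refl) (inj₂ refl) _   _   = refl
    same (inj₁ refl) (inj₁ refl) (inj₂ refl) p≢q _   = contradiction refl p≢q
    same (inj₁ refl) (inj₂ refl) (inj₁ refl) _   p≢s = contradiction refl p≢s
    same (inj₂ refl) (inj₁ refl) (inj₂ refl) _   p≢s = contradiction refl p≢s
    same (inj₂ refl) (inj₂ refl) (inj₁ refl) p≢q _   = contradiction refl p≢q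

  -- The subtree above `v` in the forest that `H` induces on two colour classes, with ranks growing
  -- away from the root.
  data Descendant (v : Fin n) : Fin n → Set where
    top   : v ∈ S → Descendant v v
    child : ∀ {x y} → Descendant v x → y ∈ S → H y x ≡ true → r x <ᶠ r y → Descendant v y

  descendant-∈ : ∀ {v x} → Descendant v x → x ∈ S
  descendant-∈ (top v∈)         = v∈
  descendant-∈ (child _ y∈ _ _) = y∈

  descendant-≤ : ∀ {v x} → Descendant v x → toℕ (r v) ≤ toℕ (r x)
  descendant-≤ (top _)           = ≤-refl
  descendant-≤ (child d _ _ x<y) = ≤-trans (descendant-≤ d) (<⇒≤ x<y)

  -- Without the edge to its parent p, no edge of G leaves the descendants of v.
  module _ {v p} (pS : p ∈ S) (vp : H v p ≡ true) (p<v : r p <ᶠ r v) (¬vp : adj G v p ≡ false) where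

    descendant-step : ∀ {x y} → Descendant v x → adj G x y ≡ true → y ∈ S → Descendant v y
    descendant-step {x} {y} d xy yS with <-cmp (r x) (r y)
    ... | tri< x<y _ _ = child d yS (G⊆H (trans (adj-sym G y x) xy)) x<y
    ... | tri≈ _ x≈y _ = contradiction x≈y (proj₁ (differ lay x y (G⊆H xy)))
    ... | tri> _ _ y<x = up d
      where
      -- A step down in rank leads to the unique parent: from `v` this would be `p`, a missing edge;
      -- from any other descendant it is the vertex through which that one was reached.
      up : Descendant v x → Descendant v y
      up (top vS) with unique-parent vS yS pS (G⊆H xy) vp y<x p<v
      ... | refl with () ← trans (sym xy) ¬vp
      up (child d′ xS xx′ x′<x) with unique-parent xS yS (descendant-∈ d′) (G⊆H xy) xx′ y<x x′<x
      ... | refl = d′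

    descendant-forward : ∀ {x y} → Descendant v x → Walk (adj G) (_∈ S) x y → Descendant v y
    descendant-forward d (here _)     = d
    descendant-forward d (step _ e w) = descendant-forward (descendant-step d e (∈-start w)) w

    descendant-backward : ∀ {x y} → Descendant v y → Walk (adj G) (_∈ S) x y → Descendant v x
    descendant-backward d (here _) = d
    descendant-backward d (step {x} {y} x∈ e w) =
      descendant-step (descendant-backward d w) (trans (adj-sym G y x) e) x∈

  -- Were the edge missing, the walk would stay among the descendants of the higher-ranked endpoint,
  -- whose ranks are no smaller than its own; but the other endpoint ranks strictly lower.
  bichromatic-connected⇒adjacent : ∀ {u v} → H u v ≡ true → H v u ≡ true → u ∈ S → v ∈ S →
                                   ConnectedIn G S u v → adj G u v ≡ true
  bichromatic-connected⇒adjacent {u} {v} uv vu u∈ v∈ walk with adj G u v in eq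
  ... | true  = refl
  ... | false with <-cmp (r u) (r v)
  ...   | tri< u<v _ _ = contradiction u<v (≤⇒≯ (descendant-≤
            (descendant-backward u∈ vu u<v (trans (adj-sym G v u) eq) (top v∈) walk)))
  ...   | tri≈ _ u≈v _ = contradiction u≈v (proj₁ (differ lay u v uv))
  ...   | tri> _ _ v<u = contradiction v<u (≤⇒≯ (descendant-≤
            (descendant-forward v∈ uv v<u eq (top u∈) walk)))

-- Query strategies of the two phases

askAll : ∀ {n} → List (Subset n) → (List (Answer n) → QueryTree n) → QueryTree n
askAll []       next = next []
askAll (S ∷ Ss) next = ask S λ A → askAll Ss λ As → next (A ∷ As)

run-askAll : ∀ {n} (o : Subset n → Answer n) Ss next →
             let E , q = run o (next (List.map o Ss)) in run o (askAll Ss next) ≡ (E , length Ss + q)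
run-askAll o []       next = refl
run-askAll o (S ∷ Ss) next rewrite run-askAll o Ss (λ As → next (o S ∷ As)) = refl

-- Answers are false outside the query, so `A u u` and `A v v` test that both vertices were queried.
separates : ∀ {n} → Fin n → Fin n → Answer n → Bool
separates u v A = A u u ∧ A v v ∧ not (A u v)

candidate : ∀ {n} → List (Answer n) → Fin n → Fin n → Bool
candidate As u v = not (does (u ≟ v)) ∧ not (any (separates u v) As)

colourPairs : ∀ {n K} → (Fin n → Fin K) → List (Subset n)
colourPairs {K = K} c = List.map (λ (a , b) → bichromatic c a b) (cartesianProduct (allFin K) (allFin K))

-- Both orientations of `H` are required, since symmetry of the candidate relation is not part of
-- its type.
decode : ∀ {n} → (Fin n → Fin n → Bool) → List (Answer n) → Fin n → Fin n → Bool
decode H Bs u v = H u v ∧ H v u ∧ any (λ B → B u v) Bs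

colourPhase : ∀ {n M K} (H : Fin n → Fin n → Bool) → Dec (Layering M K H) → QueryTree n
colourPhase H (yes (_ , c , _)) = askAll (colourPairs (lookup c)) λ Bs → output (decode H Bs)
-- An arbitrary output: correctness is claimed only when a layering exists.
colourPhase H (no _)            = output λ _ _ → false

reconstruct : ∀ {n} → ℕ → List (Answer n) → QueryTree n
reconstruct {n} k As = colourPhase (candidate As) (layering? (n * n) (suc k) (candidate As))

∧-true : ∀ {x y} → x ∧ y ≡ true → x ≡ true × y ≡ true
∧-true {true} {true} _ = refl , refl

∈-end : ∀ {m a} {P : Fin m → Set} {s t} → Walk a P s t → P t
∈-end (here p)     = p
∈-end (step _ _ w) = ∈-end w

length-cartesianProduct : ∀ {A B : Set} (xs : List A) (ys : List B) →
                          length (cartesianProduct xs ys) ≡ length xs * length ys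
length-cartesianProduct []       ys = refl
length-cartesianProduct (x ∷ xs) ys = trans (length-++ (List.map (x ,_) ys))
  (cong₂ _+_ (length-map (x ,_) ys) (length-cartesianProduct xs ys))

length-allPairs : ∀ n → length (cartesianProduct (allFin n) (allFin n)) ≡ n * n
length-allPairs n = trans (length-cartesianProduct (allFin n) (allFin n))
  (cong₂ _*_ (length-tabulate {n = n} λ i → i) (length-tabulate {n = n} λ i → i))

colourPhase-queries : ∀ {n M K} o {H : Fin n → Fin n → Bool} (d : Dec (Layering M K H)) →
                      proj₂ (run o (colourPhase H d)) ≤ K * K
colourPhase-queries o (no _) = z≤n
colourPhase-queries {K = K} o {H} (yes (_ , c , _))
  rewrite run-askAll o (colourPairs (lookup c)) (λ Bs → output (decode H Bs)) = ≤-reflexive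
    (trans (+-identityʳ _) (trans (length-map _ (cartesianProduct (allFin K) (allFin K))) (length-allPairs K)))

any-true⁺ : ∀ {A : Set} (p : A → Bool) {xs} → Any (λ x → p x ≡ true) xs → any p xs ≡ true
any-true⁺ p x∈ = Equivalence.to T-≡ (any⁺ p (Any.map (Equivalence.from T-≡) x∈))

any-true⁻ : ∀ {A : Set} (p : A → Bool) xs → any p xs ≡ true → Any (λ x → p x ≡ true) xs
any-true⁻ p xs eq = Any.map (Equivalence.to T-≡) (any⁻ p xs (Equivalence.from T-≡ eq))

module _ {n} {G : SimpleGraph n} (o : CCOracle G) where

  adjacent⇒connected : ∀ {S u v} → u ∈ S → v ∈ S → adj G u v ≡ true → ans o S u v ≡ true
  adjacent⇒connected u∈ v∈ uv = compl o _ _ _ (step u∈ uv (here v∈))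

  -- Adjacent vertices that are both queried lie in one component, so no answer separates them,
  -- whatever the coins.
  adjacent⇒candidate : ∀ Ss {u v} → adj G u v ≡ true → candidate (List.map (ans o) Ss) u v ≡ true
  adjacent⇒candidate Ss {u} {v} uv with u ≟ v
  ... | yes refl with () ← trans (sym uv) (adj-irrefl G u)
  ... | no _ with any (separates u v) (List.map (ans o) Ss) in eq
  ...   | false = refl
  ...   | true with L.find (map⁻ (any-true⁻ (separates u v) (List.map (ans o) Ss) eq))
  ...     | S , _ , sep with ∧-true {ans o S u u} sep
  ...       | uu , rest with ∧-true {ans o S v v} rest
  ...         | vv , ¬uv rewrite adjacent⇒connected (∈-start (sound o S u u uu)) (∈-start (sound o S v v vv)) uv
                with () ← ¬uv

  -- The search may find a layering other than the one assumed to exist; any layering of a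
  -- supergraph of `G` decodes correctly.
  colourPhase-correct : ∀ {M K} {H : Fin n → Fin n → Bool} (d : Dec (Layering M K H)) →
                        (∀ {u v} → adj G u v ≡ true → H u v ≡ true) → Layering M K H →
                        CorrectOutput G (proj₁ (run (ans o) (colourPhase H d)))
  colourPhase-correct (no none) G⊆H l = contradiction l none
  colourPhase-correct {K = K} {H} (yes (r , c , lay)) G⊆H _ u v
    rewrite run-askAll (ans o) (colourPairs (lookup c)) (λ Bs → output (decode H Bs)) =
    ⇔→≡ {z = true} (mk⇔ decoded⇒adjacent adjacent⇒decoded)
    where
    Bs = List.map (ans o) (colourPairs (lookup c))
    decoded⇒adjacent : decode H Bs u v ≡ true → adj G u v ≡ true
    decoded⇒adjacent eq with ∧-true {H u v} {H v u ∧ any (λ B → B u v) Bs} eq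
    ... | uv , rest with ∧-true {H v u} {any (λ B → B u v) Bs} rest
    ... | vu , hit with L.find (map⁻ (map⁻ (any-true⁻ (λ B → B u v) Bs hit)))
    ... | (a , b) , _ , conn with sound o _ u v conn
    ... | walk = bichromatic-connected⇒adjacent {G = G} lay G⊆H a b uv vu (∈-start walk) (∈-end walk) walk
    adjacent⇒decoded : adj G u v ≡ true → decode H Bs u v ≡ true
    adjacent⇒decoded uv = cong₂ _∧_ (G⊆H uv) (cong₂ _∧_ (G⊆H (trans (adj-sym G v u) uv))
      (any-true⁺ (λ B → B u v) {Bs} (map⁺ (map⁺ (L.lose (∈-cartesianProduct⁺ (∈-allFin (lookup c u)) (∈-allFin (lookup c v)))
        (adjacent⇒connected (bichromaticˡ (lookup c) u) (bichromaticʳ (lookup c) v) uv))))))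

-- Counting coin sequences

-- Probabilities are handled as sums over all `2 ^ r` coin sequences, with denominators cleared
-- throughout.
total : ∀ r → (Vec Bool r → ℕ) → ℕ
total zero    f = f []
total (suc r) f = total r (λ b → f (true ∷ b)) + total r (λ b → f (false ∷ b))

total-cong : ∀ r {f g : Vec Bool r → ℕ} → (∀ b → f b ≡ g b) → total r f ≡ total r g
total-cong zero    eq = eq []
total-cong (suc r) eq = cong₂ _+_ (total-cong r λ b → eq (true ∷ b)) (total-cong r λ b → eq (false ∷ b))

total-mono : ∀ r {f g : Vec Bool r → ℕ} → (∀ b → f b ≤ g b) → total r f ≤ total r g
total-mono zero    le = le []
total-mono (suc r) le = +-mono-≤ (total-mono r λ b → le (true ∷ b)) (total-mono r λ b → le (false ∷ b))

total-+ : ∀ r (f g : Vec Bool r → ℕ) → total r (λ b → f b + g b) ≡ total r f + total r g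
total-+ zero    f g = refl
total-+ (suc r) f g = trans (cong₂ _+_ (total-+ r _ _) (total-+ r _ _))
  (solve 4 (λ a b c d → (a :+ b) :+ (c :+ d) := (a :+ c) :+ (b :+ d)) refl
    (total r (λ b → f (true ∷ b))) (total r (λ b → g (true ∷ b)))
    (total r (λ b → f (false ∷ b))) (total r (λ b → g (false ∷ b))))
  where open +-*-Solver

total-*ˡ : ∀ r c (f : Vec Bool r → ℕ) → total r (λ b → c * f b) ≡ c * total r f
total-*ˡ zero    c f = refl
total-*ˡ (suc r) c f = trans (cong₂ _+_ (total-*ˡ r c _) (total-*ˡ r c _)) (sym (*-distribˡ-+ c _ _))

total-const : ∀ r c → total r (λ _ → c) ≡ 2 ^ r * c
total-const zero    c = sym (*-identityˡ c)
total-const (suc r) c rewrite total-const r c =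
  solve 2 (λ p c → p :* c :+ p :* c := con 2 :* p :* c) refl (2 ^ r) c
  where open +-*-Solver

total-++ : ∀ r s (f : Vec Bool (r + s) → ℕ) → total (r + s) f ≡ total r (λ a → total s (λ b → f (a ++ b)))
total-++ zero    s f = refl
total-++ (suc r) s f = cong₂ _+_ (total-++ r s _) (total-++ r s _)

indicator : Bool → ℕ
indicator true  = 1
indicator false = 0

count : ∀ r → (Vec Bool r → Bool) → ℕ
count r p = total r (λ b → indicator (p b))

count-complement : ∀ r (p : Vec Bool r → Bool) → count r p + count r (λ b → not (p b)) ≡ 2 ^ r
count-complement r p = trans (sym (total-+ r _ _))
  (trans (total-cong r (λ b → split (p b))) (trans (total-const r 1) (*-identityʳ _)))
  where
  split : ∀ x → indicator x + indicator (not x) ≡ 1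
  split true  = refl
  split false = refl

count-false : ∀ r → count r (λ _ → false) ≡ 0
count-false r = trans (total-const r 0) (*-zeroʳ (2 ^ r))

take-++ : ∀ {A : Set} {m n} (xs : Vec A m) (ys : Vec A n) → take m (xs ++ ys) ≡ xs
take-++ []       ys = refl
take-++ (x ∷ xs) ys = cong (x ∷_) (take-++ xs ys)

drop-++ : ∀ {A : Set} {m n} (xs : Vec A m) (ys : Vec A n) → drop m (xs ++ ys) ≡ ys
drop-++ []       ys = refl
drop-++ (x ∷ xs) ys = drop-++ xs ys

-- Independence of disjoint blocks of coins: a sequence splits uniquely into prefix and suffix, so
-- the counts multiply.
count-independent : ∀ r s (p : Vec Bool r → Bool) (q : Vec Bool s → Bool) →
                    count (r + s) (λ b → p (take r b) ∧ q (drop r b)) ≡ count r p * count s q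
count-independent r s p q = trans (total-++ r s _)
  (trans (total-cong r λ a → trans (total-cong s (λ b → product a b)) (total-*ˡ s (indicator (p a)) _))
  (trans (total-cong r λ a → *-comm (indicator (p a)) (count s q))
  (trans (total-*ˡ r (count s q) _) (*-comm (count s q) (count r p)))))
  where
  ind-∧ : ∀ x y → indicator (x ∧ y) ≡ indicator x * indicator y
  ind-∧ true  y = sym (*-identityˡ _)
  ind-∧ false y = refl
  product : ∀ a b → indicator (p (take r (a ++ b)) ∧ q (drop r (a ++ b))) ≡ indicator (p a) * indicator (q b)
  product a b rewrite take-++ a b | drop-++ a b = ind-∧ (p a) (q b)

-- The union bound, for events that each have at most `bound / scale` favourable coin sequences.
count-any : ∀ r {A : Set} (p : A → Vec Bool r → Bool) {scale bound} → (∀ x → count r (p x) * scale ≤ bound) →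
            ∀ xs → count r (λ b → any (λ x → p x b) xs) * scale ≤ length xs * bound
count-any r p small [] rewrite count-false r = z≤n
count-any r p {scale} {bound} small (x ∷ xs) = begin
  count r (λ b → p x b ∨ any (λ y → p y b) xs) * scale
    ≤⟨ *-monoˡ-≤ scale (total-mono r λ b → ind-∨ (p x b) _) ⟩
  total r (λ b → indicator (p x b) + indicator (any (λ y → p y b) xs)) * scale
    ≡⟨ cong (_* scale) (total-+ r _ _) ⟩
  (count r (p x) + count r (λ b → any (λ y → p y b) xs)) * scale
    ≡⟨ *-distribʳ-+ scale (count r (p x)) _ ⟩
  count r (p x) * scale + count r (λ b → any (λ y → p y b) xs) * scale
    ≤⟨ +-mono-≤ (small x) (count-any r p small xs) ⟩
  bound + length xs * bound ∎
  where
  open ≤-Reasoning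
  ind-∨ : ∀ x y → indicator (x ∨ y) ≤ indicator x + indicator y
  ind-∨ true  y = s≤s z≤n
  ind-∨ false y = ≤-refl

-- Passes from the list in `failureCount` to `count` while enlarging the event. Inside, `g` prepends
-- the bits already fixed, so that the induction can follow `allBits`.
filter-allBits : ∀ r {P : Vec Bool r → Set} (P? : ∀ b → Dec (P b)) (f : Vec Bool r → Bool) →
                 (∀ b → P b → f b ≡ true) → length (filter P? (allBits r)) ≤ count r f
filter-allBits r {P} P? f P⇒f = subst (λ bs → length (filter P? bs) ≤ count r f) (map-id (allBits r)) (go r (λ b → b))
  where
  go : ∀ s (g : Vec Bool s → Vec Bool r) → length (filter P? (List.map g (allBits s))) ≤ count s (λ b → f (g b))
  go zero g with P? (g [])
  ... | no _  = z≤n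
  ... | yes p rewrite P⇒f (g []) p = ≤-refl
  go (suc s) g
    rewrite map-++ g (List.map (true ∷_) (allBits s)) (List.map (false ∷_) (allBits s))
          | filter-++ P? (List.map g (List.map (true ∷_) (allBits s))) (List.map g (List.map (false ∷_) (allBits s)))
          | length-++ (filter P? (List.map g (List.map (true ∷_) (allBits s)))) {filter P? (List.map g (List.map (false ∷_) (allBits s)))}
          | sym (map-∘ {g = g} {f = true ∷_} (allBits s))
          | sym (map-∘ {g = g} {f = false ∷_} (allBits s)) =
    +-mono-≤ (go s (g ∘ (true ∷_))) (go s (g ∘ (false ∷_)))

-- Random vertex sets that contain one set and miss another

allTrue : ∀ {j} → Vec Bool j → Bool
allTrue []      = true
allTrue (x ∷ b) = x ∧ allTrue b

-- Each vertex is kept when its j coins all come up true, that is with probability 2⁻ʲ.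
sample : ∀ j n → Vec Bool (n * j) → Subset n
sample j zero    b = []
sample j (suc n) b = allTrue (take j b) ∷ sample j n (drop j b)

samples : ∀ j n m → Vec Bool (m * (n * j)) → List (Subset n)
samples j n zero    b = []
samples j n (suc m) b = sample j n (take (n * j) b) ∷ samples j n m (drop (n * j) b)

length-samples : ∀ j n m b → length (samples j n m b) ≡ m
length-samples j n zero    b = refl
length-samples j n (suc m) b = cong suc (length-samples j n m _)

-- Where the set to contain and the set to miss overlap, the former wins; the counting below then
-- needs no disjointness.
fit : Bool → Bool → Bool → Bool
fit inside  _       s = s
fit outside inside  s = not s
fit outside outside s = true

fits : ∀ {n} → Subset n → Subset n → Subset n → Bool
fits []      []      []      = true
fits (x ∷ X) (y ∷ Y) (s ∷ S) = fit x y s ∧ fits X Y S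

fits-∈ : ∀ {n} (X Y S : Subset n) {x} → fits X Y S ≡ true → x ∈ X → x ∈ S
fits-∈ (inside ∷ X) (y ∷ Y) (true ∷ S) eq here        = here
fits-∈ (inside ∷ X) (y ∷ Y) (true ∷ S) eq (there x∈)  = there (fits-∈ X Y S eq x∈)
fits-∈ (outside ∷ X) (y ∷ Y) (s ∷ S) eq (there x∈) with fit outside y s
... | true = there (fits-∈ X Y S eq x∈)

fits-∉ : ∀ {n} (X Y S : Subset n) {x} → fits X Y S ≡ true → x ∈ Y → x ∉ X → x ∉ S
fits-∉ (inside ∷ X)  (y ∷ Y) (s ∷ S)    eq here x∉X _ = x∉X here
fits-∉ (outside ∷ X) (y ∷ Y) (true ∷ S) () here x∉X here
fits-∉ (x ∷ X) (y ∷ Y) (s ∷ S) eq (there x∈Y) x∉X (there x∈S) with fit x y s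
... | true = fits-∉ X Y S eq x∈Y (x∉X ∘ there) x∈S

count-allTrue : ∀ j → count j allTrue ≡ 1
count-allTrue zero    = refl
count-allTrue (suc j) = trans (cong₂ _+_ (count-allTrue j) (count-false j)) refl

-- With `q = 2 ^ j`, a vertex is kept with probability 1/q and dropped with probability e/q; naming
-- the predecessor `e` avoids subtraction.
module _ (j e : ℕ) (2^j : 2 ^ j ≡ suc e) where

  private
    q : ℕ
    q = suc e

  count-some-false : count j (λ b → not (allTrue b)) ≡ e
  count-some-false = +-cancelˡ-≡ 1 _ _
    (trans (cong (_+ count j (λ b → not (allTrue b))) (sym (count-allTrue j)))
           (trans (count-complement j allTrue) 2^j))

  -- Vertices are drawn independently, so a fit has probability at least (1/q) to the size of `X`
  -- times (e/q) to the size of `Y`.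
  count-fits : ∀ {n} (X Y : Subset n) →
               2 ^ (n * j) * e ^ ∣ Y ∣ ≤ count (n * j) (λ b → fits X Y (sample j n b)) * q ^ (∣ X ∣ + ∣ Y ∣)
  count-fits [] [] = ≤-refl
  count-fits {suc n} (x ∷ X) (y ∷ Y)
    rewrite count-independent j (n * j) (λ b → fit x y (allTrue b)) (λ b → fits X Y (sample j n b))
          | ^-distribˡ-+-* 2 j (n * j) | 2^j = combine x y
    where
    open ≤-Reasoning
    open +-*-Solver
    N A P E : ℕ
    N = 2 ^ (n * j)
    A = count (n * j) (λ b → fits X Y (sample j n b))
    P = q ^ (∣ X ∣ + ∣ Y ∣)
    E = e ^ ∣ Y ∣
    IH : N * E ≤ A * P
    IH = count-fits X Y
    combine : ∀ x y → q * N * e ^ ∣ y ∷ Y ∣ ≤ count j (λ b → fit x y (allTrue b)) * A * q ^ (∣ x ∷ X ∣ + ∣ y ∷ Y ∣)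
    combine outside outside rewrite total-const j 1 | 2^j = begin
      q * N * E          ≡⟨ *-assoc q N E ⟩
      q * (N * E)        ≤⟨ *-monoʳ-≤ q IH ⟩
      q * (A * P)        ≡⟨ solve 3 (λ q a p → q :* (a :* p) := q :* con 1 :* a :* p) refl q A P ⟩
      q * 1 * A * P      ∎
    combine outside inside rewrite count-some-false | +-suc ∣ X ∣ ∣ Y ∣ = begin
      q * N * (e * E)    ≡⟨ solve 4 (λ q n e E → q :* n :* (e :* E) := q :* e :* (n :* E)) refl q N e E ⟩
      q * e * (N * E)    ≤⟨ *-monoʳ-≤ (q * e) IH ⟩
      q * e * (A * P)    ≡⟨ solve 4 (λ q e a p → q :* e :* (a :* p) := e :* a :* (q :* p)) refl q e A P ⟩
      e * A * (q * P)    ∎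
    combine inside outside rewrite count-allTrue j = begin
      q * N * E          ≡⟨ *-assoc q N E ⟩
      q * (N * E)        ≤⟨ *-monoʳ-≤ q IH ⟩
      q * (A * P)        ≡⟨ solve 3 (λ q a p → q :* (a :* p) := con 1 :* a :* (q :* p)) refl q A P ⟩
      1 * A * (q * P)    ∎
    -- On an overlap the true factor 1/q is at least the claimed e/q².
    combine inside inside rewrite count-allTrue j | +-suc ∣ X ∣ ∣ Y ∣ = begin
      q * N * (e * E)        ≡⟨ solve 4 (λ q n e E → q :* n :* (e :* E) := e :* (q :* (n :* E))) refl q N e E ⟩
      e * (q * (N * E))      ≤⟨ *-mono-≤ (n≤1+n e) (*-monoʳ-≤ q IH) ⟩
      q * (q * (A * P))      ≡⟨ solve 3 (λ q a p → q :* (q :* (a :* p)) := con 1 :* a :* (q :* (q :* p))) refl q A P ⟩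
      1 * A * (q * (q * P))  ∎

  -- Bernoulli's inequality (1 - 1/q)ʸ ≥ 1 - y/q with denominators cleared.
  bernoulli : ∀ y → q ^ y * q ≤ e ^ y * q + y * q ^ y
  bernoulli zero    = m≤m+n _ _
  bernoulli (suc y) = begin
    q * q ^ y * q                        ≡⟨ *-assoc q (q ^ y) q ⟩
    q * (q ^ y * q)                      ≤⟨ *-monoʳ-≤ q (bernoulli y) ⟩
    q * (e ^ y * q + y * q ^ y)          ≡⟨ solve 4 (λ e E Q y → (con 1 :+ e) :* (E :* (con 1 :+ e) :+ y :* Q)
                                              := E :* (con 1 :+ e) :+ (e :* E :* (con 1 :+ e) :+ y :* ((con 1 :+ e) :* Q)))
                                              refl e (e ^ y) (q ^ y) y ⟩
    e ^ y * q + (e * e ^ y * q + y * (q * q ^ y))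
      ≤⟨ +-monoˡ-≤ _ (*-monoˡ-≤ q (^-monoˡ-≤ y (n≤1+n e))) ⟩
    q ^ y * q + (e * e ^ y * q + y * (q * q ^ y))
      ≡⟨ solve 4 (λ q Q a b → Q :* q :+ (a :+ b) := a :+ (q :* Q :+ b)) refl q (q ^ y) (e * e ^ y * q) (y * (q * q ^ y)) ⟩
    e * e ^ y * q + (q * q ^ y + y * (q * q ^ y)) ∎
    where
    open ≤-Reasoning
    open +-*-Solver

  -- For y at most q/2, Bernoulli's inequality gives (1 - 1/q)ʸ ≥ 1/2; adding it to itself avoids
  -- halving.
  half-power : ∀ y → y + y ≤ q → q ^ y ≤ e ^ y * 2
  half-power y 2y≤q = *-cancelʳ-≤ (q ^ y) (e ^ y * 2) q (+-cancelʳ-≤ (q ^ y * q) _ _ (begin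
    q ^ y * q + q ^ y * q                                ≤⟨ +-mono-≤ (bernoulli y) (bernoulli y) ⟩
    (e ^ y * q + y * q ^ y) + (e ^ y * q + y * q ^ y)    ≡⟨ solve 4 (λ q y E Q → (E :* q :+ y :* Q) :+ (E :* q :+ y :* Q)
                                                              := E :* con 2 :* q :+ Q :* (y :+ y)) refl q y (e ^ y) (q ^ y) ⟩
    e ^ y * 2 * q + q ^ y * (y + y)                      ≤⟨ +-monoʳ-≤ _ (*-monoʳ-≤ (q ^ y) 2y≤q) ⟩
    e ^ y * 2 * q + q ^ y * q                            ∎))
    where
    open ≤-Reasoning
    open +-*-Solver

  -- Containing `X` costs at most 1/q² and missing `Y` at most 1/2, so a draw fits with probability
  -- at least 1/(2q²).
  fits-often : ∀ {n} (X Y : Subset n) → ∣ X ∣ ≤ 2 → ∣ Y ∣ + ∣ Y ∣ ≤ q →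
               2 ^ (n * j) ≤ count (n * j) (λ b → fits X Y (sample j n b)) * (q * q * 2)
  fits-often {n} X Y ∣X∣≤2 2Y≤q = *-cancelʳ-≤ N (A * (q * q * 2)) (q ^ ∣ Y ∣) {{m^n≢0 q ∣ Y ∣}} (begin
    N * q ^ ∣ Y ∣                        ≤⟨ *-monoʳ-≤ N (half-power ∣ Y ∣ 2Y≤q) ⟩
    N * (e ^ ∣ Y ∣ * 2)                  ≡⟨ *-assoc N (e ^ ∣ Y ∣) 2 ⟨
    N * e ^ ∣ Y ∣ * 2                    ≤⟨ *-monoˡ-≤ 2 (count-fits X Y) ⟩
    A * q ^ (∣ X ∣ + ∣ Y ∣) * 2          ≤⟨ *-monoˡ-≤ 2 (*-monoʳ-≤ A (^-monoʳ-≤ q (+-monoˡ-≤ ∣ Y ∣ ∣X∣≤2))) ⟩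
    A * (q * (q * q ^ ∣ Y ∣)) * 2        ≡⟨ solve 3 (λ a q p → a :* (q :* (q :* p)) :* con 2 := a :* (q :* q :* con 2) :* p)
                                              refl A q (q ^ ∣ Y ∣) ⟩
    A * (q * q * 2) * q ^ ∣ Y ∣          ∎)
    where
    open ≤-Reasoning
    open +-*-Solver
    N A : ℕ
    N = 2 ^ (n * j)
    A = count (n * j) (λ b → fits X Y (sample j n b))

-- Amplification by independent draws

^-distribʳ-* : ∀ m n k → (m * n) ^ k ≡ m ^ k * n ^ k
^-distribʳ-* m n zero    = refl
^-distribʳ-* m n (suc k) rewrite ^-distribʳ-* m n k =
  solve 4 (λ m n x y → m :* n :* (x :* y) := m :* x :* (n :* y)) refl m n (m ^ k) (n ^ k)
  where open +-*-Solver

-- (1 + 1/a)ᵏ ≥ 1 + k/a with denominators cleared.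
bernoulli⁺ : ∀ a k → a ^ k * (a + k) ≤ suc a ^ k * a
bernoulli⁺ a zero    = ≤-reflexive (cong (_+ 0) (+-identityʳ a))
bernoulli⁺ a (suc k) = begin
  a * a ^ k * (a + suc k)                   ≤⟨ m≤m+n _ (a ^ k * k) ⟩
  a * a ^ k * (a + suc k) + a ^ k * k       ≡⟨ solve 3 (λ a k p → a :* p :* (a :+ (con 1 :+ k)) :+ p :* k
                                                 := (con 1 :+ a) :* (p :* (a :+ k))) refl a k (a ^ k) ⟩
  suc a * (a ^ k * (a + k))                 ≤⟨ *-monoʳ-≤ (suc a) (bernoulli⁺ a k) ⟩
  suc a * (suc a ^ k * a)                   ≡⟨ *-assoc (suc a) (suc a ^ k) a ⟨
  suc a * suc a ^ k * a                     ∎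
  where
  open ≤-Reasoning
  open +-*-Solver

-- With Q = a + 1 this is (1 - 1/Q) to the power Q being at most 1/2, the case `k = suc a` of
-- `bernoulli⁺`.
power-halves : ∀ a → .{{NonZero a}} → a ^ suc a * 2 ≤ suc a ^ suc a
power-halves a = *-cancelʳ-≤ _ _ a (begin
  a ^ suc a * 2 * a          ≤⟨ ≤-trans (m≤m+n _ (a ^ suc a)) (≤-reflexive (solve 2 (λ a p → p :* con 2 :* a :+ p
                                  := p :* (a :+ (con 1 :+ a))) refl a (a ^ suc a))) ⟩
  a ^ suc a * (a + suc a)    ≤⟨ bernoulli⁺ a (suc a) ⟩
  suc a ^ suc a * a          ∎)
  where
  open ≤-Reasoning
  open +-*-Solver

-- One draw is bad with probability at most 1 - 1/Q, so `Q` draws are all bad with probability at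
-- most 1/2, and `Q * t` draws with probability at most 1/2ᵗ.
amplify : ∀ {good bad N Q} → 2 ≤ Q → ∀ t → good + bad ≡ N → N ≤ good * Q →
          bad ^ (Q * t) * 2 ^ t ≤ N ^ (Q * t)
amplify {good} {bad} {N} {Q@(suc (suc a′))} (s≤s (s≤s z≤n)) t g+b≡N N≤ = begin
  bad ^ (Q * t) * 2 ^ t      ≡⟨ cong (_* 2 ^ t) (sym (^-*-assoc bad Q t)) ⟩
  (bad ^ Q) ^ t * 2 ^ t      ≡⟨ ^-distribʳ-* (bad ^ Q) 2 t ⟨
  (bad ^ Q * 2) ^ t          ≤⟨ ^-monoˡ-≤ t one-round ⟩
  (N ^ Q) ^ t                ≡⟨ ^-*-assoc N Q t ⟩
  N ^ (Q * t)                ∎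
  where
  open ≤-Reasoning
  open +-*-Solver
  a : ℕ
  a = suc a′
  bad*Q≤ : bad * Q ≤ N * a
  bad*Q≤ = +-cancelˡ-≤ N _ _ (begin
    N + bad * Q            ≤⟨ +-monoˡ-≤ _ N≤ ⟩
    good * Q + bad * Q     ≡⟨ *-distribʳ-+ Q good bad ⟨
    (good + bad) * Q       ≡⟨ cong (_* Q) g+b≡N ⟩
    N * Q                  ≡⟨ *-suc N a ⟩
    N + N * a              ∎)
  one-round : bad ^ Q * 2 ≤ N ^ Q
  one-round = *-cancelʳ-≤ _ _ (Q ^ Q) {{m^n≢0 Q Q}} (begin
    bad ^ Q * 2 * Q ^ Q    ≡⟨ solve 2 (λ b q → b :* con 2 :* q := b :* q :* con 2) refl (bad ^ Q) (Q ^ Q) ⟩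
    bad ^ Q * Q ^ Q * 2    ≡⟨ cong (_* 2) (^-distribʳ-* bad Q Q) ⟨
    (bad * Q) ^ Q * 2      ≤⟨ *-monoˡ-≤ 2 (^-monoˡ-≤ Q bad*Q≤) ⟩
    (N * a) ^ Q * 2        ≡⟨ cong (_* 2) (^-distribʳ-* N a Q) ⟩
    N ^ Q * a ^ Q * 2      ≡⟨ *-assoc (N ^ Q) (a ^ Q) 2 ⟩
    N ^ Q * (a ^ Q * 2)    ≤⟨ *-monoʳ-≤ (N ^ Q) (power-halves a) ⟩
    N ^ Q * Q ^ Q          ∎)

count-all-samples : ∀ j n m (p : Subset n → Bool) →
                    count (m * (n * j)) (λ b → all p (samples j n m b)) ≡ count (n * j) (λ b → p (sample j n b)) ^ m
count-all-samples j n zero    p = refl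
count-all-samples j n (suc m) p = trans
  (count-independent (n * j) (m * (n * j)) (λ b → p (sample j n b)) (λ b → all p (samples j n m b)))
  (cong (count (n * j) (λ b → p (sample j n b)) *_) (count-all-samples j n m p))

-- `amplify` with Q = 2q², the reciprocal of the success probability in `fits-often`.
rarely-unfit : ∀ j t {n} (X Y : Subset n) → ∣ X ∣ ≤ 2 → ∣ Y ∣ + ∣ Y ∣ ≤ 2 ^ j →
               let m = 2 ^ j * 2 ^ j * 2 * t in
               count (m * (n * j)) (λ b → all (λ S → not (fits X Y S)) (samples j n m b)) * 2 ^ t ≤ 2 ^ (m * (n * j))
rarely-unfit j t {n} X Y ∣X∣≤2 2Y≤q = begin
  count (m * (n * j)) (λ b → all (λ S → not (fits X Y S)) (samples j n m b)) * 2 ^ t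
    ≡⟨ cong (_* 2 ^ t) (count-all-samples j n m (λ S → not (fits X Y S))) ⟩
  count (n * j) (λ b → not (fits X Y (sample j n b))) ^ m * 2 ^ t
    ≤⟨ amplify 2≤Q t (count-complement (n * j) (λ b → fits X Y (sample j n b))) often ⟩
  (2 ^ (n * j)) ^ m    ≡⟨ ^-*-assoc 2 (n * j) m ⟩
  2 ^ (n * j * m)      ≡⟨ cong (2 ^_) (*-comm (n * j) m) ⟩
  2 ^ (m * (n * j))    ∎
  where
  open ≤-Reasoning
  m : ℕ
  m = 2 ^ j * 2 ^ j * 2 * t
  2≤Q : 2 ≤ 2 ^ j * 2 ^ j * 2
  2≤Q = *-monoˡ-≤ 2 (*-mono-≤ (m^n>0 2 j) (m^n>0 2 j))
  often : 2 ^ (n * j) ≤ count (n * j) (λ b → fits X Y (sample j n b)) * (2 ^ j * 2 ^ j * 2)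
  often with 2 ^ j in eq | m^n>0 2 j
  ... | suc e | _ = fits-often j e eq X Y ∣X∣≤2 2Y≤q

-- The algorithm

n≤2^⌈log₂n⌉ : ∀ n → n ≤ 2 ^ ⌈log₂ n ⌉
n≤2^⌈log₂n⌉ = <-rec _ go
  where
  open ≤-Reasoning
  go : ∀ n → (∀ {m} → m < n → m ≤ 2 ^ ⌈log₂ m ⌉) → n ≤ 2 ^ ⌈log₂ n ⌉
  go zero _ = z≤n
  go (suc zero) _ = s≤s z≤n
  go n@(suc (suc n′)) rec = begin
    n                                     ≡⟨ ⌊n/2⌋+⌈n/2⌉≡n n ⟨
    ⌊ n /2⌋ + ⌈ n /2⌉                     ≤⟨ +-monoˡ-≤ ⌈ n /2⌉ (⌊n/2⌋≤⌈n/2⌉ n) ⟩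
    ⌈ n /2⌉ + ⌈ n /2⌉                     ≡⟨ cong (⌈ n /2⌉ +_) (+-identityʳ ⌈ n /2⌉) ⟨
    2 * ⌈ n /2⌉                           ≤⟨ *-monoʳ-≤ 2 (rec (⌈n/2⌉<n n′)) ⟩
    2 * 2 ^ ⌈log₂ ⌈ n /2⌉ ⌉               ≡⟨ cong (λ l → 2 * 2 ^ l) (⌈log₂⌈n/2⌉⌉≡⌈log₂n⌉∸1 n) ⟩
    2 ^ suc (⌈log₂ n ⌉ ∸ 1)               ≡⟨ cong (2 ^_) (m+[n∸m]≡n (⌈log₂⌉-mono-≤ {2} {n} (s≤s (s≤s z≤n)))) ⟩
    2 ^ ⌈log₂ n ⌉                         ∎

-- Coins only realise powers of two. The lower bound makes separators small enough to miss, the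
-- upper one keeps the number of draws quadratic.
power-above : ∀ k → ∃ λ i → suc k ≤ 2 ^ i × 2 ^ i ≤ 2 * suc k
power-above zero = 0 , ≤-refl , s≤s z≤n
power-above (suc k) with power-above k
... | i , k<2^i , 2^i≤ with suc (suc k) ≤? 2 ^ i
...   | yes large = i , large , ≤-trans 2^i≤ (*-monoʳ-≤ 2 (n≤1+n (suc k)))
...   | no ¬large = suc i , ≤-trans (s≤s (m≤n+m (suc k) k)) (≤-trans (≤-reflexive double) (*-monoʳ-≤ 2 k<2^i))
                 , *-monoʳ-≤ 2 (<⇒≤ (≰⇒> ¬large))
  where
  double : suc k + suc k ≡ 2 * suc k
  double = cong (suc k +_) (sym (+-identityʳ (suc k)))

-- The argument is the treewidth K minus one. The extra coin gives 2K ≤ q ≤ 4K for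
-- `q = 2 ^ coins k`, so twice the size of a separator is at most q.
coins : ℕ → ℕ
coins k = suc (proj₁ (power-above k))

-- The factor 3 brings the chance of missing a given pair down to n⁻³, which still leaves 1/n after
-- a union over n² pairs.
rounds : ℕ → ℕ → ℕ
rounds n k = 2 ^ coins k * 2 ^ coins k * 2 * (3 * ⌈log₂ n ⌉)

bitCount : ℕ → ℕ → ℕ
bitCount n zero    = 0
bitCount n (suc k) = rounds n k * (n * coins k)

strategy : ∀ n k → Vec Bool (bitCount n k) → QueryTree n
-- Treewidth zero, or fewer than two vertices, forces an edgeless graph; the query bound is zero in
-- these cases.
strategy n               zero    _ = output λ _ _ → false
strategy zero            (suc k) _ = output λ _ _ → false
strategy (suc zero)      (suc k) _ = output λ _ _ → false
strategy n@(suc (suc _)) (suc k) b = askAll (samples (coins k) n (rounds n k) b) (reconstruct (suc k))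

algorithm : RandomizedAlgorithm
algorithm = record { bits = bitCount ; alg = strategy }

-- By q ≤ 4K the draws cost at most 96K²l, and the colour pairs cost (K + 1)² ≤ 4K² ≤ 4K²l, which
-- makes 100.
query-bound : ∀ k l → 1 ≤ l → 2 ^ coins k * 2 ^ coins k * 2 * (3 * l) + suc (suc k) * suc (suc k) ≤ 100 * (suc k * suc k) * l
query-bound k l 1≤l = begin
  q * q * 2 * (3 * l) + suc K * suc K
    ≤⟨ +-mono-≤ (*-monoˡ-≤ (3 * l) (*-monoˡ-≤ 2 (*-mono-≤ q≤ q≤)))
                (≤-trans (*-mono-≤ sucK≤ sucK≤) (≤-trans (≤-reflexive (sym (*-identityʳ _))) (*-monoʳ-≤ (2 * K * (2 * K)) 1≤l))) ⟩
  4 * K * (4 * K) * 2 * (3 * l) + 2 * K * (2 * K) * l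
    ≡⟨ solve 5 (λ a b c k l → a :* k :* (a :* k) :* b :* (c :* l) :+ b :* k :* (b :* k) :* l
         := (a :* a :* b :* c :+ b :* b) :* (k :* k) :* l) refl 4 2 3 K l ⟩
  100 * (K * K) * l ∎
  where
  open ≤-Reasoning
  open +-*-Solver
  K q : ℕ
  K = suc k
  q = 2 ^ coins k
  q≤ : q ≤ 4 * K
  q≤ = ≤-trans (*-monoʳ-≤ 2 (proj₂ (proj₂ (power-above k)))) (≤-reflexive (sym (*-assoc 2 2 K)))
  sucK≤ : suc K ≤ 2 * K
  sucK≤ = ≤-trans (s≤s (m≤n+m K k)) (≤-reflexive (cong (K +_) (sym (+-identityʳ K))))

queries-bounded : ∀ n k {G : SimpleGraph n} (o : CCOracle G) b →
                  queriesUsed algorithm k G o b ≤ 100 * (k * k) * ⌈log₂ n ⌉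
queries-bounded n               zero    o b = z≤n
queries-bounded zero            (suc k) o b = z≤n
queries-bounded (suc zero)      (suc k) o b = z≤n
queries-bounded n@(suc (suc _)) (suc k) o b =
  ≤-trans (≤-reflexive (cong proj₂ (run-askAll (ans o) (samples (coins k) n (rounds n k) b) (reconstruct (suc k)))))
  (≤-trans (+-mono-≤ (≤-reflexive (length-samples (coins k) n (rounds n k) b))
                     (colourPhase-queries (ans o) (layering? (n * n) (suc (suc k)) _)))
           (query-bound k ⌈log₂ n ⌉ (⌈log₂⌉-mono-≤ {2} {n} (s≤s (s≤s z≤n)))))

-- Correctness and failure probability

all-false⁻ : ∀ {A : Set} (p : A → Bool) xs → all p xs ≡ false → Any (λ x → p x ≡ false) xs
all-false⁻ p (x ∷ xs) eq with p x in px
... | true  = there (all-false⁻ p xs eq)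
... | false = here px

-- Carries separation over from shared bags to `G`: every edge lies in a bag, and a walk inside `S`
-- avoids the separator.
side-along-walk : ∀ {n w} {G : SimpleGraph n} {bs : List (Subset n)} {u v} (s : Separation bs w u v) {S} →
                  (∀ {x y} → adj G x y ≡ true → Share bs x y) → (∀ {x} → x ∈ separator s → x ∉ S) →
                  ∀ {x y} → ConnectedIn G S x y → side s x ≡ side s y
side-along-walk s edges avoid (here _) = refl
side-along-walk {G = G} s edges avoid (step x∈ e w) =
  trans (constant s (edges e) (λ x∈W → avoid x∈W x∈) (λ y∈W → avoid y∈W (∈-start w)))
        (side-along-walk {G = G} s edges avoid w)

pair : ∀ {n} → Fin n → Fin n → Subset n
pair u v = ⁅ u ⁆ ∪ ⁅ v ⁆

∣pair∣≤2 : ∀ {n} (u v : Fin n) → ∣ pair u v ∣ ≤ 2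
∣pair∣≤2 u v = ≤-trans (∣p∪q∣≤∣p∣+∣q∣ ⁅ u ⁆ ⁅ v ⁆) (+-mono-≤ (≤-reflexive (∣⁅x⁆∣≡1 u)) (≤-reflexive (∣⁅x⁆∣≡1 v)))

-- The separator contains neither `u` nor `v`, so a fitting draw misses it entirely, and `side`
-- tells the two components apart.
fits⇒separates : ∀ {n w} {G : SimpleGraph n} (o : CCOracle G) {bs : List (Subset n)} {u v}
                 (s : Separation bs w u v) S → (∀ {x y} → adj G x y ≡ true → Share bs x y) →
                 fits (pair u v) (separator s) S ≡ true → separates u v (ans o S) ≡ true
fits⇒separates {G = G} o {u = u} {v} s S edges fit
  rewrite compl o S u u (here (fits-∈ _ _ S fit (x∈p∪q⁺ (inj₁ (x∈⁅x⁆ u)))))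
        | compl o S v v (here (fits-∈ _ _ S fit (x∈p∪q⁺ {p = ⁅ u ⁆} (inj₂ (x∈⁅x⁆ v)))))
  with ans o S u v in eq
... | false = refl
... | true  = contradiction (side-along-walk {G = G} s edges avoid (sound o S u v eq)) (apart s)
  where
  not-pair : ∀ {x} → x ∈ separator s → x ∉ pair u v
  not-pair x∈W x∈ with x∈p∪q⁻ ⁅ u ⁆ ⁅ v ⁆ x∈
  ... | inj₁ x∈u rewrite x∈⁅y⁆⇒x≡y u x∈u = u∉ s x∈W
  ... | inj₂ x∈v rewrite x∈⁅y⁆⇒x≡y v x∈v = v∉ s x∈W
  avoid : ∀ {x} → x ∈ separator s → x ∉ S
  avoid x∈W = fits-∉ _ _ S fit x∈W (not-pair x∈W)

candidate⇒≢ : ∀ {n} As {u v : Fin n} → candidate As u v ≡ true → u ≢ v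
candidate⇒≢ As {u} {v} cand with u ≟ v
... | no u≢v = u≢v

separated⇒¬candidate : ∀ {n} As {u v : Fin n} → Any (λ A → separates u v A ≡ true) As → candidate As u v ≢ true
separated⇒¬candidate As {u} {v} sep cand =
  contradiction (trans (sym (cong not (any-true⁺ (separates u v) sep))) (proj₂ (∧-true {not (does (u ≟ v))} cand))) λ ()

module _ {n k} {G : SimpleGraph n} (o : CCOracle G) {bs : List (Subset n)}
         (running : RunningIntersection bs) (small : All (λ b → ∣ b ∣ ≤ suc (suc k)) bs)
         (occurs : ∀ x → Occurs bs x) (edges : ∀ {u v} → adj G u v ≡ true → Share bs u v) where

  private
    j m R : ℕ
    j = coins k
    m = rounds n k
    R = m * (n * j)

    queried : Vec Bool R → List (Subset n)
    queried = samples j n m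

    answers : Vec Bool R → List (Answer n)
    answers b = List.map (ans o) (queried b)

  -- The separator of a pair is fixed before any coin is tossed, so the union bound runs over pairs,
  -- not over separators.
  missed-by : ∀ {u v} → Dec (Share bs u v) → Vec Bool R → Bool
  missed-by         (yes _)  b = false
  missed-by {u} {v} (no ¬sh) b =
    all (λ S → not (fits (pair u v) (separator (separation running small (occurs u) (occurs v) ¬sh)) S)) (queried b)

  missed : Fin n × Fin n → Vec Bool R → Bool
  missed (u , v) = missed-by (share? bs u v)

  missed-rare : ∀ uv → count R (missed uv) * 2 ^ (3 * ⌈log₂ n ⌉) ≤ 2 ^ R
  missed-rare (u , v) = go (share? bs u v)
    where
    go : (d : Dec (Share bs u v)) → count R (missed-by d) * 2 ^ (3 * ⌈log₂ n ⌉) ≤ 2 ^ R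
    go (yes _) rewrite count-false R = z≤n
    go (no ¬sh) = rarely-unfit j (3 * ⌈log₂ n ⌉) (pair u v) (separator s) (∣pair∣≤2 u v)
      (≤-trans (+-mono-≤ ∣W∣≤ ∣W∣≤) (≤-reflexive (cong (2 ^ proj₁ (power-above k) +_) (sym (+-identityʳ _)))))
      where
      s : Separation bs (suc k) u v
      s = separation running small (occurs u) (occurs v) ¬sh
      ∣W∣≤ : ∣ separator s ∣ ≤ 2 ^ proj₁ (power-above k)
      ∣W∣≤ = ≤-trans (size s) (proj₁ (proj₂ (power-above k)))

  hit⇒share : ∀ {u v} b → missed (u , v) b ≡ false → candidate (answers b) u v ≡ true → Share bs u v
  hit⇒share {u} {v} b = go (share? bs u v)
    where
    go : (d : Dec (Share bs u v)) → missed-by d b ≡ false → candidate (answers b) u v ≡ true → Share bs u v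
    go (yes sh) _ _ = sh
    go (no ¬sh) hit cand = contradiction cand (separated⇒¬candidate (answers b)
      (map⁺ (Any.map (λ {S} eq → fits⇒separates o s S edges (not-false eq)) (all-false⁻ _ (queried b) hit))))
      where
      s : Separation bs (suc k) u v
      s = separation running small (occurs u) (occurs v) ¬sh
      not-false : ∀ {x} → not x ≡ false → x ≡ true
      not-false {true} _ = refl

  fails : Vec Bool R → Bool
  fails b = any (λ uv → missed uv b) (cartesianProduct (allFin n) (allFin n))

  -- When no pair is missed, all candidates share bags; the elimination ordering then guarantees
  -- that the search succeeds.
  ¬fails⇒correct : ∀ b → fails b ≡ false →
                   CorrectOutput G (proj₁ (run (ans o) (askAll (queried b) (reconstruct (suc k)))))
  ¬fails⇒correct b ok rewrite run-askAll (ans o) (queried b) (reconstruct (suc k)) =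
    colourPhase-correct o (layering? (n * n) (suc (suc k)) (candidate (answers b)))
      (adjacent⇒candidate o (queried b))
      (elimination⇒layering (elimination running small) occurs λ {u} {v} cand →
        candidate⇒≢ (answers b) cand , hit⇒share b (hit u v) cand)
    where
    hit : ∀ u v → missed (u , v) b ≡ false
    hit u v with missed (u , v) b in eq
    ... | false = refl
    ... | true with () ← trans (sym ok) (any-true⁺ (λ uv → missed uv b)
                     (L.lose (∈-cartesianProduct⁺ (∈-allFin u) (∈-allFin v)) eq))

  -- There are n² pairs, each missed with probability at most n⁻³; multiplying by n² and cancelling
  -- it leaves 1/n.
  fails-rare : .{{_ : NonZero n}} → count R fails * n ≤ 2 ^ R
  fails-rare = *-cancelʳ-≤ _ _ (n * n) {{m*n≢0 n n}} (begin
    count R fails * n * (n * n)                ≡⟨ *-assoc (count R fails) n (n * n) ⟩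
    count R fails * (n * (n * n))              ≤⟨ *-monoʳ-≤ (count R fails) n³≤ ⟩
    count R fails * 2 ^ (3 * ⌈log₂ n ⌉)        ≤⟨ count-any R missed missed-rare (cartesianProduct (allFin n) (allFin n)) ⟩
    length (cartesianProduct (allFin n) (allFin n)) * 2 ^ R  ≡⟨ cong (_* 2 ^ R) (length-allPairs n) ⟩
    n * n * 2 ^ R                              ≡⟨ *-comm (n * n) (2 ^ R) ⟩
    2 ^ R * (n * n)                            ∎)
    where
    open ≤-Reasoning
    l : ℕ
    l = ⌈log₂ n ⌉
    n³≤ : n * (n * n) ≤ 2 ^ (3 * l)
    n³≤ = begin
      n * (n * n)          ≡⟨ cong (λ x → n * (n * x)) (*-identityʳ n) ⟨
      n ^ 3                ≤⟨ ^-monoˡ-≤ 3 (n≤2^⌈log₂n⌉ n) ⟩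
      (2 ^ l) ^ 3          ≡⟨ ^-*-assoc 2 l 3 ⟩
      2 ^ (l * 3)          ≡⟨ cong (2 ^_) (*-comm l 3) ⟩
      2 ^ (3 * l)          ∎

  failures-rare : .{{_ : NonZero n}} →
                  length (filter (λ b → ¬? (correct? G (proj₁ (run (ans o) (askAll (queried b) (reconstruct (suc k)))))))
                                 (allBits R)) * n ≤ 2 ^ R
  failures-rare = ≤-trans (*-monoˡ-≤ n (filter-allBits R _ fails failing)) fails-rare
    where
    failing : ∀ b → ¬ CorrectOutput G (proj₁ (run (ans o) (askAll (queried b) (reconstruct (suc k))))) → fails b ≡ true
    failing b ¬correct with fails b in eq
    ... | true  = refl
    ... | false = contradiction (¬fails⇒correct b eq) ¬correct

-- An edge would put two distinct vertices into a bag of size at most one.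
width-zero⇒edgeless : ∀ {n} {G : SimpleGraph n} (D : TreeDecomposition G) → WidthAtMost D 0 → ∀ u v → adj G u v ≡ false
width-zero⇒edgeless {G = G} D width u v with adj G u v in uv
... | false = refl
... | true with edgeCover D u v uv
...   | t , u∈ , v∈ = contradiction (≤-trans (s≤s (m<n⇒0<n (x∈p⇒∣p-x∣<∣p∣ v∈b-u))) (≤-trans (x∈p⇒∣p-x∣<∣p∣ u∈) (width t))) (<-irrefl refl)
  where
  v≢u : v ≢ u
  v≢u refl with () ← trans (sym uv) (adj-irrefl G u)
  v∈b-u : v ∈ bag D t - u
  v∈b-u = x∈p∧x≢y⇒x∈p-y v∈ v≢u

failure-bound : ∀ n k {G : SimpleGraph n} (D : TreeDecomposition G) → WidthAtMost D k → (o : CCOracle G) → 2 ≤ n →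
                failureCount algorithm k G o * n ≤ 2 ^ bitCount n k
failure-bound n zero {G} D width o _ =
  ≤-trans (*-monoˡ-≤ n (filter-allBits 0 (λ _ → ¬? (correct? G (λ _ _ → false))) (λ _ → false) never)) z≤n
  where
  never : ∀ b → ¬ CorrectOutput G (λ _ _ → false) → false ≡ true
  never _ ¬correct = contradiction (λ u v → sym (width-zero⇒edgeless D width u v)) ¬correct
failure-bound (suc zero) (suc k) D width o (s≤s ())
failure-bound n@(suc (suc _)) (suc k) D width o _ =
  let bs , running , small , occurs , edges = bag-sequence D width in
  failures-rare {k = k} o running small occurs edges

theorem5 : Σ RandomizedAlgorithm λ A →
    (∃ λ C → ∀ n k (G : SimpleGraph n) → HasTreewidth G k → (o : CCOracle G) →
    (b : Vec Bool (bits A n k)) → queriesUsed A k G o b ≤ C * (k * k) * ⌈log₂ n ⌉)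
    ×
    (∀ m → ∃ λ N → ∀ n → N ≤ n → ∀ k (G : SimpleGraph n) → HasTreewidth G k →
    (o : CCOracle G) → failureCount A k G o * suc m ≤ 2 ^ bits A n k)
theorem5 = algorithm
  , (100 , λ n k G _ o b → queries-bounded n k o b)
  -- This threshold gives both n ≥ 2 and n ≥ m + 1, so the failure probability 1/n is at most 1/(m +
  -- 1).
  , λ m → suc (suc m) , λ n N≤n k G ((D , width) , _) o →
      ≤-trans (*-monoʳ-≤ (failureCount algorithm k G o) (≤-trans (n≤1+n (suc m)) N≤n))
              (failure-bound n k D width o (≤-trans (s≤s (s≤s z≤n)) N≤n))
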